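{- Let $G$ be a graph, let $l$ be a nonincreasing intersecting supermodular nonnegative integer-valued function on subsets of $V(G)$, and let $\ell$ be a $2$-intersecting supermodular subadditive nonnegative integer-valued function on subsets of $V(G)$. Suppose $d_G(v)\ge 2\ell(v)+2l(v)$ for each vertex $v$, and for any two disjoint vertex sets $A,B$ with $A\cup B\subsetneq V(G)$ and $e_G(A\cup B)>\sum_{v\in A\cup B}\ell(v)-\ell(A\cup B)$, $$d_{G-B}(A)\ge 2\ell(A\cup B)-\sum_{v\in B}\ell(v)+\begin{cases}0,&\text{if }A=\emptyset;\\ 2l(A\cup B),&\text{if }A\neq\emptyset.\end{cases}$$ Then for every edge set $M\subseteq E(G)$ with $|M|\le l(V(G))+\ell(V(G))$, the edge set of $G$ can be decomposed into $M$, the edge set of a spanning $l$-partition-connected subgraph, and the edge set of a spanning $\ell$-rigid subgraph (these three being pairwise disjoint).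
   Context: Graphs are finite, loopless, multiple edges allowed. $d_{G-B}(A)$ is the number of edges of $G-B$ with exactly one end in $A$; $e_H(X)$ the number of edges of $H$ with both ends in $X$; $e_H(P)$ the number of edges joining different parts of a partition $P$. Set functions are zero on $\emptyset$, $f(v)=f(\{v\})$. $f$ is $c$-intersecting supermodular if $f(A\cap B)+f(A\cup B)\ge f(A)+f(B)$ whenever $|A\cap B|\ge c$ (intersecting: $c=1$); subadditive if $f(A)+f(B)\ge f(A\cup B)$ for disjoint $A,B$; nonincreasing if $f(A)\ge f(B)$ for nonempty $A\subseteq B$. A graph $H$ is $f$-partition-connected if $e_H(P)\ge\sum_{X\in P}f(X)-f(V(H))$ for all partitions $P$ of $V(H)$, and $f$-rigid if it has a spanning subgraph $F$ with $e_F(X)\le\sum_{v\in X}f(v)-f(X)$ for all $X$ and $|E(F)|=\sum_{v\in V(H)}f(v)-f(V(H))$. -}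

module Defs where

open import Data.Nat using (ℕ; zero; suc; _+_; _*_; _≤_; _<_)
open import Data.Bool using (Bool; true; false; if_then_else_; _∧_; _∨_; not; _xor_)
open import Data.Fin using (Fin; zero; suc)
open import Data.Vec using (lookup)
open import Data.Fin.Subset using (Subset; ⁅_⁆; _∩_; _∪_; _⊆_; _⊂_; ∣_∣; ⊥; ⊤; Nonempty)
open import Data.Product using (_×_; Σ; ∃; _,_)
open import Relation.Binary.PropositionalEquality using (_≡_; _≢_)
open import Function using (_∘_)

-- Multigraph (loopless, multiple edges allowed) on vertex set Fin n with
-- edges Fin m; edge e joins end₁ e and end₂ e.
record Graph : Set where
  field
    n        : ℕ
    m        : ℕ
    end₁     : Fin m → Fin n
    end₂     : Fin m → Fin n
    loopless : ∀ e → end₁ e ≢ end₂ e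
open Graph public

count : ∀ {k} → (Fin k → Bool) → ℕ
count {zero}  p = 0
count {suc k} p = (if p zero then 1 else 0) + count (p ∘ suc)

sumOver : ∀ {k} → Subset k → (Fin k → ℕ) → ℕ
sumOver {zero}  X g = 0
sumOver {suc k} X g = (if lookup X zero then g zero else 0) + sumOver (λ' X) (g ∘ suc)
  where
  λ' : Subset (suc k) → Subset k
  λ' (_ Data.Vec.∷ xs) = xs

SetFun : ℕ → Set
SetFun k = Subset k → ℕ

pt : ∀ {k} → SetFun k → Fin k → ℕ
pt f v = f ⁅ v ⁆

sumPt : ∀ {k} → SetFun k → Subset k → ℕ
sumPt f X = sumOver X (pt f)

ZeroOnEmpty : ∀ {k} → SetFun k → Set
ZeroOnEmpty f = f ⊥ ≡ 0

IntersectingSupermodular : ∀ {k} → ℕ → SetFun k → Set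
IntersectingSupermodular c f =
  ∀ A B → c ≤ ∣ A ∩ B ∣ → f A + f B ≤ f (A ∩ B) + f (A ∪ B)

Subadditive : ∀ {k} → SetFun k → Set
Subadditive f = ∀ A B → A ∩ B ≡ ⊥ → f (A ∪ B) ≤ f A + f B

Nonincreasing : ∀ {k} → SetFun k → Set
Nonincreasing f = ∀ A B → Nonempty A → A ⊆ B → f B ≤ f A

module _ (G : Graph) where
  in₁ in₂ : Subset (n G) → Fin (m G) → Bool
  in₁ X e = lookup X (end₁ G e)
  in₂ X e = lookup X (end₂ G e)

  degree : Fin (n G) → ℕ
  degree v = count (λ e → in₁ ⁅ v ⁆ e ∨ in₂ ⁅ v ⁆ e)

  eIn : Subset (m G) → Subset (n G) → ℕ
  eIn F X = count (λ e → lookup F e ∧ (in₁ X e ∧ in₂ X e))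

  dMinus : Subset (n G) → Subset (n G) → ℕ
  dMinus B A = count (λ e → not (in₁ B e) ∧ (not (in₂ B e) ∧ (in₁ A e xor in₂ A e)))

  -- A partition of V(G) into k nonempty parts: a surjection p : V → Fin k,
  -- the parts being the fibres p⁻¹(i).
  record Partition : Set where
    field
      k    : ℕ
      part : Fin (n G) → Fin k
      surj : ∀ i → ∃ λ v → part v ≡ i

  fibre : (P : Partition) → Fin (Partition.k P) → Subset (n G)
  fibre P i = Data.Vec.tabulate (λ v → isEq (Partition.part P v) i)
    where
    isEq : ∀ {j} → Fin j → Fin j → Bool
    isEq zero    zero    = true
    isEq zero    (suc _) = false
    isEq (suc _) zero    = false
    isEq (suc a) (suc b) = isEq a b

  eCross : Subset (m G) → Partition → ℕ
  eCross F P = count (λ e → lookup F e ∧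
                 not (lookup (fibre P (Partition.part P (end₁ G e))) (end₂ G e)))

  sumParts : SetFun (n G) → Partition → ℕ
  sumParts f P = sumOver {Partition.k P} ⊤ (λ i → f (fibre P i))

  -- the spanning subgraph (V(G), F) is f-partition-connected
  -- (e_F(P) ≥ Σ_{X∈P} f(X) − f(V), stated without truncated subtraction)
  PartitionConnected : SetFun (n G) → Subset (m G) → Set
  PartitionConnected f F = ∀ (P : Partition) → sumParts f P ≤ eCross F P + f ⊤

  Rigid : SetFun (n G) → Subset (m G) → Set
  Rigid f F = ∃ λ (F' : Subset (m G)) → F' ⊆ F ×
                ((∀ X → eIn F' X + f X ≤ sumPt f X) ×
                 (∣ F' ∣ + f ⊤ ≡ sumPt f ⊤))

{-# OPTIONS --safe #-}
module Submission where

open import Defs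
open import Data.Bool using (Bool; true; false; if_then_else_; _∧_; _∨_; not; _xor_)
open import Data.Bool.ListAction using (any; all)
open import Data.Bool.Properties using (∧-comm; ∧-zeroʳ) renaming (_≟_ to _≟ᵇ_)
open import Data.Empty using () renaming (⊥ to Empty; ⊥-elim to absurd)
open import Data.Fin using (Fin; zero; suc)
open import Data.Fin.Patterns using (0F; 1F; 2F)
open import Data.Fin.Properties using (any?) renaming (_≟_ to _≟ᶠ_)
open import Data.Fin.Subset using (Subset; ⁅_⁆; _∩_; _∪_; _⊆_; _⊂_; ∁; ∣_∣; ⊥; ⊤; ⋃; Nonempty)
open import Data.Fin.Subset.Properties using (x∈p⇒∣p-x∣<∣p∣; x∈p∧x≢y⇒x∈p-y; nonempty?; anySubset?; ∩-zeroʳ; ∩-identityʳ; ∩-distribˡ-∪; ∩-comm; p⊆p∪q; ∪-identityˡ; ∪-identityʳ; ∪-inverseˡ; ∪-inverseʳ; ∪-assoc; x∈⁅x⁆)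
open import Data.List as List using (List; []; _∷_; _++_; length)
open import Data.List.Relation.Unary.All as All using (All; []; _∷_)
open import Data.List.Relation.Unary.All.Properties using (¬Any⇒All¬)
open import Data.List.Relation.Unary.Any as Any using (Any; here; there)
open import Data.Nat
open import Data.Nat.Induction using (<-wellFounded; Acc; acc)
open import Data.Nat.Properties
open import Data.Nat.Tactic.RingSolver using (solve-∀)
open import Data.Product using (_×_; _,_; ∃; ∃₂; proj₁; proj₂)
open import Data.Sum using (_⊎_; inj₁; inj₂)
open import Data.Vec as Vec using (lookup)
open import Data.Vec.Functional using (updateAt)
open import Data.Vec.Functional.Properties using (updateAt-updates; updateAt-minimal)
open import Data.Vec.Properties using (lookup∘tabulate; tabulate∘lookup; tabulate-cong; lookup-zipWith; lookup-map; lookup-replicate; lookup⇒[]=; []=⇒lookup; ≡-dec)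
open import Function using (_∘_; const)
open import Relation.Binary.PropositionalEquality
open import Relation.Nullary using (¬_; Dec; yes; no; does)
open import Relation.Nullary.Decidable using (_×-dec_; ¬?; decidable-stable; dec-true)
import Algebra.Properties.Semiring.Sum +-*-semiring as Sum

-- Write f(X) = Σ_{v∈X} ℓ(v) - ℓ(X) and g(X) = Σ_{v∈X} l(v) - l(X). It suffices to find disjoint edge
-- sets F₁, F₂ avoiding M with e_{F₁}(X) ≤ g(X) and e_{F₂}(X) ≤ f(X) for all X, and with equality for
-- X = V. They are obtained from a Rado-type argument: every edge outside M gets the list of colours
-- {g, f, waste}, where waste has the constant cost m - g(V) - f(V), and the edges of M get {waste}. The
-- Hall condition says that for families of vertex sets, one for each colour, the number of edges
-- covered in all colours of their lists is at most the total cost of the families. As the costs are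
-- submodular on sets sharing an edge, two families can be uncrossed, and hence the lists can be
-- shrunk to single colours without losing the Hall condition.
--
-- To verify the Hall condition, merge the family of colour g into a partition P and intersect the
-- members X of the family of colour f with the parts Y of P; as g is submodular on intersecting sets
-- and ℓ subadditive, neither step increases the cost. Members with e_G(X) ≤ f(X) can be dropped. For the others, apply the hypothesis to B, the
-- vertices of X lying in a further member, and A = X \ B, and sum up the uncovered edges at A and at
-- the vertices lying in no member. This yields the term l(Y) unless all vertices of Y lie in at
-- least two members; in that case the edges leaving Y provide it if Y ≠ V, and it is not needed if
-- Y = V.

-- Booleans and their indicator values

⟦_⟧ : Bool → ℕ
⟦ b ⟧ = if b then 1 else 0

⟦⟧≤1 : ∀ b → ⟦ b ⟧ ≤ 1
⟦⟧≤1 true  = ≤-refl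
⟦⟧≤1 false = z≤n

∧-true : ∀ {a b} → a ∧ b ≡ true → a ≡ true × b ≡ true
∧-true {true} {true} _ = refl , refl

∧-intro : ∀ {a b} → a ≡ true → b ≡ true → a ∧ b ≡ true
∧-intro refl refl = refl

∨-true : ∀ {a b} → a ∨ b ≡ true → a ≡ true ⊎ b ≡ true
∨-true {true}  _ = inj₁ refl
∨-true {false} p = inj₂ p

∨-introˡ : ∀ {a b} → a ≡ true → a ∨ b ≡ true
∨-introˡ refl = refl

∨-introʳ : ∀ {a b} → b ≡ true → a ∨ b ≡ true
∨-introʳ {true}  _ = refl
∨-introʳ {false} p = p

true≢false : ∀ {a} → a ≡ true → a ≡ false → Empty
true≢false refl ()

not-true⇒false : ∀ {a} → not a ≡ true → a ≡ false
not-true⇒false {false} _ = refl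

⟦⟧-mono : ∀ {a b} → (a ≡ true → b ≡ true) → ⟦ a ⟧ ≤ ⟦ b ⟧
⟦⟧-mono {false} _ = z≤n
⟦⟧-mono {true}  p rewrite p refl = ≤-refl

-- Finite sums

-- Opaque, so that unification recovers the summand from a sum.
opaque

  ∑ : ∀ {k} → (Fin k → ℕ) → ℕ
  ∑ = Sum.sum

  ∑-cong : ∀ {k} {f g : Fin k → ℕ} → (∀ i → f i ≡ g i) → ∑ f ≡ ∑ g
  ∑-cong = Sum.sum-cong-≗

  ∑-+ : ∀ {k} (f g : Fin k → ℕ) → ∑ (λ i → f i + g i) ≡ ∑ f + ∑ g
  ∑-+ = Sum.∑-distrib-+

  ∑-comm : ∀ {j k} (f : Fin j → Fin k → ℕ) → ∑ (λ i → ∑ (f i)) ≡ ∑ (λ j → ∑ (λ i → f i j))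
  ∑-comm = Sum.∑-comm

  ∑-*ˡ : ∀ {k} x (f : Fin k → ℕ) → x * ∑ f ≡ ∑ (λ i → x * f i)
  ∑-*ˡ = Sum.*-distribˡ-sum

  ∑-*ʳ : ∀ {k} x (f : Fin k → ℕ) → ∑ f * x ≡ ∑ (λ i → f i * x)
  ∑-*ʳ = Sum.*-distribʳ-sum

  ∑-zero : ∀ {k} {f : Fin k → ℕ} → (∀ i → f i ≡ 0) → ∑ f ≡ 0
  ∑-zero {k} p = trans (Sum.sum-cong-≗ p) (Sum.sum-replicate-zero k)

  ∑-suc : ∀ {k} (f : Fin (suc k) → ℕ) → ∑ f ≡ f zero + ∑ (f ∘ suc)
  ∑-suc f = refl

  ∑-mono : ∀ {k} {f g : Fin k → ℕ} → (∀ i → f i ≤ g i) → ∑ f ≤ ∑ g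
  ∑-mono {zero}  p = z≤n
  ∑-mono {suc k} p = +-mono-≤ (p zero) (∑-mono (p ∘ suc))

  term≤∑ : ∀ {k} (f : Fin k → ℕ) i → f i ≤ ∑ f
  term≤∑ f zero    = m≤m+n _ _
  term≤∑ f (suc i) = ≤-trans (term≤∑ (f ∘ suc) i) (m≤n+m _ _)

  ∑-δ : ∀ {k} (u : Fin k) (y : Fin k → ℕ) → ∑ (λ v → ⟦ does (u ≟ᶠ v) ⟧ * y v) ≡ y u
  ∑-δ {suc k} zero    y = trans (cong₂ _+_ (*-identityˡ (y zero)) (∑-zero {k} (λ _ → refl))) (+-identityʳ _)
  ∑-δ {suc k} (suc u) y = ∑-δ u (y ∘ suc)

∑ᴸ : ∀ {A : Set} → List A → (A → ℕ) → ℕ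
∑ᴸ []      f = 0
∑ᴸ (x ∷ L) f = f x + ∑ᴸ L f

∑ᴸ≡∑ : ∀ {A : Set} (L : List A) f → ∑ᴸ L f ≡ ∑ (λ i → f (List.lookup L i))
∑ᴸ≡∑ []      f = sym (∑-zero λ ())
∑ᴸ≡∑ (x ∷ L) f = trans (cong (f x +_) (∑ᴸ≡∑ L f)) (sym (∑-suc _))

∑ᴸ-++ : ∀ {A : Set} (K L : List A) f → ∑ᴸ (K ++ L) f ≡ ∑ᴸ K f + ∑ᴸ L f
∑ᴸ-++ []      L f = refl
∑ᴸ-++ (x ∷ K) L f = trans (cong (f x +_) (∑ᴸ-++ K L f)) (sym (+-assoc (f x) _ _))

∑ᴸ-tabulate : ∀ {A : Set} {k} (g : Fin k → A) f → ∑ᴸ (List.tabulate g) f ≡ ∑ (f ∘ g)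
∑ᴸ-tabulate {k = zero}  g f = sym (∑-zero λ ())
∑ᴸ-tabulate {k = suc k} g f = trans (cong (f (g zero) +_) (∑ᴸ-tabulate (g ∘ suc) f)) (sym (∑-suc _))

∑ᴸ-map : ∀ {A B : Set} (g : A → B) L f → ∑ᴸ (List.map g L) f ≡ ∑ᴸ L (f ∘ g)
∑ᴸ-map g []      f = refl
∑ᴸ-map g (x ∷ L) f = cong (f (g x) +_) (∑ᴸ-map g L f)

∑ᴸ-mono : ∀ {A : Set} {L : List A} {f g : A → ℕ} → All (λ x → f x ≤ g x) L → ∑ᴸ L f ≤ ∑ᴸ L g
∑ᴸ-mono []       = z≤n
∑ᴸ-mono (p ∷ ps) = +-mono-≤ p (∑ᴸ-mono ps)

∑ᴸ-cong : ∀ {A : Set} (L : List A) {f g : A → ℕ} → (∀ x → f x ≡ g x) → ∑ᴸ L f ≡ ∑ᴸ L g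
∑ᴸ-cong []      p = refl
∑ᴸ-cong (x ∷ L) p = cong₂ _+_ (p x) (∑ᴸ-cong L p)

∑ᴸ-+ : ∀ {A : Set} (L : List A) (f g : A → ℕ) → ∑ᴸ L (λ x → f x + g x) ≡ ∑ᴸ L f + ∑ᴸ L g
∑ᴸ-+ L f g = trans (∑ᴸ≡∑ L _) (trans (∑-+ _ _) (sym (cong₂ _+_ (∑ᴸ≡∑ L f) (∑ᴸ≡∑ L g))))

∑ᴸ-*ˡ : ∀ {A : Set} (L : List A) x (f : A → ℕ) → x * ∑ᴸ L f ≡ ∑ᴸ L (λ y → x * f y)
∑ᴸ-*ˡ L x f = trans (cong (x *_) (∑ᴸ≡∑ L f)) (trans (∑-*ˡ x _) (sym (∑ᴸ≡∑ L _)))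

∑ᴸ-*ʳ : ∀ {A : Set} (L : List A) x (f : A → ℕ) → ∑ᴸ L f * x ≡ ∑ᴸ L (λ y → f y * x)
∑ᴸ-*ʳ L x f = trans (cong (_* x) (∑ᴸ≡∑ L f)) (trans (∑-*ʳ x _) (sym (∑ᴸ≡∑ L _)))

∑ᴸ-∑-comm : ∀ {A : Set} {k} (L : List A) (f : A → Fin k → ℕ) → ∑ᴸ L (λ x → ∑ (f x)) ≡ ∑ (λ i → ∑ᴸ L (λ x → f x i))
∑ᴸ-∑-comm L f = trans (∑ᴸ≡∑ L _) (trans (∑-comm _) (∑-cong λ i → sym (∑ᴸ≡∑ L _)))

∑ᴸ-comm : ∀ {A B : Set} (K : List A) (L : List B) (f : A → B → ℕ) → ∑ᴸ K (λ x → ∑ᴸ L (f x)) ≡ ∑ᴸ L (λ y → ∑ᴸ K (λ x → f x y))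
∑ᴸ-comm K L f = trans (∑ᴸ-cong K (λ x → ∑ᴸ≡∑ L _)) (trans (∑ᴸ-∑-comm K _) (sym (∑ᴸ≡∑ L _)))

count≡∑ : ∀ {k} (p : Fin k → Bool) → count p ≡ ∑ (⟦_⟧ ∘ p)
count≡∑ {zero}  p = sym (∑-zero λ ())
count≡∑ {suc k} p = trans (cong (⟦ p zero ⟧ +_) (count≡∑ (p ∘ suc))) (sym (∑-suc _))

sumOver≡∑ : ∀ {k} (X : Subset k) g → sumOver X g ≡ ∑ (λ v → ⟦ lookup X v ⟧ * g v)
sumOver≡∑ {zero}  X               g = sym (∑-zero λ ())
sumOver≡∑ {suc k} (true Vec.∷ X)  g =
  trans (cong₂ _+_ (sym (*-identityˡ (g zero))) (sumOver≡∑ X (g ∘ suc))) (sym (∑-suc _))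
sumOver≡∑ {suc k} (false Vec.∷ X) g = trans (sumOver≡∑ X (g ∘ suc)) (sym (∑-suc _))

card≡∑ : ∀ {k} (X : Subset k) → ∣ X ∣ ≡ ∑ (λ v → ⟦ lookup X v ⟧)
card≡∑ Vec.[]          = sym (∑-zero λ ())
card≡∑ (true Vec.∷ X)  = trans (cong suc (card≡∑ X)) (sym (∑-suc _))
card≡∑ (false Vec.∷ X) = trans (card≡∑ X) (sym (∑-suc _))

-- Boolean membership in subsets

lookup-⊥ : ∀ {k} (v : Fin k) → lookup ⊥ v ≡ false
lookup-⊥ v = lookup-replicate v false

lookup-⊤ : ∀ {k} (v : Fin k) → lookup ⊤ v ≡ true
lookup-⊤ v = lookup-replicate v true

lookup-∩ : ∀ {k} (X Y : Subset k) v → lookup (X ∩ Y) v ≡ lookup X v ∧ lookup Y v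
lookup-∩ X Y v = lookup-zipWith _∧_ v X Y

lookup-∪ : ∀ {k} (X Y : Subset k) v → lookup (X ∪ Y) v ≡ lookup X v ∨ lookup Y v
lookup-∪ X Y v = lookup-zipWith _∨_ v X Y

∩-intro : ∀ {k} (X Y : Subset k) {v} → lookup X v ≡ true → lookup Y v ≡ true → lookup (X ∩ Y) v ≡ true
∩-intro X Y {v} p q = trans (lookup-∩ X Y v) (∧-intro p q)

∩-elim : ∀ {k} (X Y : Subset k) {v} → lookup (X ∩ Y) v ≡ true → lookup X v ≡ true × lookup Y v ≡ true
∩-elim X Y {v} p = ∧-true (trans (sym (lookup-∩ X Y v)) p)

∪-introˡ : ∀ {k} (X Y : Subset k) {v} → lookup X v ≡ true → lookup (X ∪ Y) v ≡ true
∪-introˡ X Y {v} p = trans (lookup-∪ X Y v) (∨-introˡ p)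

∪-introʳ : ∀ {k} (X Y : Subset k) {v} → lookup Y v ≡ true → lookup (X ∪ Y) v ≡ true
∪-introʳ X Y {v} p = trans (lookup-∪ X Y v) (∨-introʳ {lookup X v} p)

∪-elim : ∀ {k} (X Y : Subset k) {v} → lookup (X ∪ Y) v ≡ true → lookup X v ≡ true ⊎ lookup Y v ≡ true
∪-elim X Y {v} p = ∨-true (trans (sym (lookup-∪ X Y v)) p)

lookup-∁ : ∀ {k} (X : Subset k) v → lookup (∁ X) v ≡ not (lookup X v)
lookup-∁ X v = lookup-map v not X

lookup-⁅⁆ : ∀ {k} (v u : Fin k) → lookup ⁅ v ⁆ u ≡ does (u ≟ᶠ v)
lookup-⁅⁆ zero    zero    = refl
lookup-⁅⁆ zero    (suc u) = lookup-⊥ u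
lookup-⁅⁆ (suc v) zero    = refl
lookup-⁅⁆ (suc v) (suc u) = lookup-⁅⁆ v u

subset-ext : ∀ {k} {X Y : Subset k} → (∀ v → lookup X v ≡ lookup Y v) → X ≡ Y
subset-ext {X = X} {Y} p = trans (sym (tabulate∘lookup X)) (trans (tabulate-cong p) (tabulate∘lookup Y))

empty-ext : ∀ {k} {X : Subset k} → (∀ v → lookup X v ≡ true → Empty) → X ≡ ⊥
empty-ext {X = X} p = subset-ext λ v → lem v (lookup X v) refl
  where
  lem : ∀ v b → lookup X v ≡ b → lookup X v ≡ lookup ⊥ v
  lem v true  q = absurd (p v q)
  lem v false q = trans q (sym (lookup-⊥ v))

empty⇒≡⊥ : ∀ {k} (X : Subset k) → ¬ Nonempty X → X ≡ ⊥
empty⇒≡⊥ X e = empty-ext λ v p → e (v , lookup⇒[]= v X p)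

2≤card : ∀ {k} (X : Subset k) {u w} → u ≢ w → lookup X u ≡ true → lookup X w ≡ true → 2 ≤ ∣ X ∣
2≤card X {u} {w} u≢w p q =
  ≤-trans (s≤s (≤-trans (s≤s z≤n) (x∈p⇒∣p-x∣<∣p∣ w∈X-u))) (x∈p⇒∣p-x∣<∣p∣ (lookup⇒[]= u X p))
  where w∈X-u = x∈p∧x≢y⇒x∈p-y (lookup⇒[]= w X q) (u≢w ∘ sym)

-- Colouring edges by a Rado-type argument

Submodular₂ : ∀ {k} → SetFun k → Set
Submodular₂ f = ∀ A B → 2 ≤ ∣ A ∩ B ∣ → f (A ∩ B) + f (A ∪ B) ≤ f A + f B

all-mono : ∀ {A : Set} {p q : A → Bool} xs → (∀ x → p x ≡ true → q x ≡ true) → all p xs ≡ true → all q xs ≡ true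
all-mono []       h _ = refl
all-mono (x ∷ xs) h a = ∧-intro (h x (proj₁ (∧-true a))) (all-mono xs h (proj₂ (∧-true a)))

all-mono₂ : ∀ {A : Set} {p q r : A → Bool} xs → (∀ x → p x ≡ true → q x ≡ true → r x ≡ true) →
  all p xs ≡ true → all q xs ≡ true → all r xs ≡ true
all-mono₂ []       h _ _ = refl
all-mono₂ (x ∷ xs) h a b =
  ∧-intro (h x (proj₁ (∧-true a)) (proj₁ (∧-true b))) (all-mono₂ xs h (proj₂ (∧-true a)) (proj₂ (∧-true b)))

module Cover (G : Graph) where

  inside : Subset (n G) → Fin (m G) → Bool
  inside X e = in₁ G X e ∧ in₂ G X e

  covers : List (Subset (n G)) → Fin (m G) → Bool
  covers L e = any (λ X → inside X e) L

  ends-inside : ∀ X e → inside X e ≡ true → lookup X (end₁ G e) ≡ true × lookup X (end₂ G e) ≡ true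
  ends-inside X e = ∧-true {lookup X (end₁ G e)}

  inside-∩ : ∀ X Y e → inside X e ≡ true → inside Y e ≡ true → inside (X ∩ Y) e ≡ true
  inside-∩ X Y e p q with ends-inside X e p | ends-inside Y e q
  ... | p₁ , p₂ | q₁ , q₂ = ∧-intro (∩-intro X Y p₁ q₁) (∩-intro X Y p₂ q₂)

  inside-∪ˡ : ∀ X Y e → inside X e ≡ true → inside (X ∪ Y) e ≡ true
  inside-∪ˡ X Y e p with ends-inside X e p
  ... | p₁ , p₂ = ∧-intro (∪-introˡ X Y p₁) (∪-introˡ X Y p₂)

  inside-∪ʳ : ∀ X Y e → inside Y e ≡ true → inside (X ∪ Y) e ≡ true
  inside-∪ʳ X Y e p with ends-inside Y e p
  ... | p₁ , p₂ = ∧-intro (∪-introʳ X Y p₁) (∪-introʳ X Y p₂)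

  -- Looplessness enters here: an edge has two distinct ends, so sets sharing an edge satisfy the
  -- size condition of `Submodular₂`.
  inside⇒2≤card : ∀ X e → inside X e ≡ true → 2 ≤ ∣ X ∣
  inside⇒2≤card X e p = 2≤card X (loopless G e) (proj₁ (ends-inside X e p)) (proj₂ (ends-inside X e p))

  covers-++ : ∀ K L e → covers K e ≡ true ⊎ covers L e ≡ true → covers (K ++ L) e ≡ true
  covers-++ []      L e (inj₂ q) = q
  covers-++ (X ∷ K) L e (inj₁ p) with ∨-true {inside X e} p
  ... | inj₁ q = ∨-introˡ q
  ... | inj₂ q = ∨-introʳ {inside X e} (covers-++ K L e (inj₁ q))
  covers-++ (X ∷ K) L e (inj₂ q) = ∨-introʳ {inside X e} (covers-++ K L e (inj₂ q))

  module Uncrossing (f : SetFun (n G)) (submod : Submodular₂ f) where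

    -- `S` is carried along the list. When it shares an edge with `T`, the intersection goes into
    -- `I` and the union is carried on in place of `S`; submodularity pays for this exchange.
    -- Otherwise `T` stays in `U`, since submodularity may fail and no edge needs an intersection.
    insert : ∀ L S → ∃₂ λ U I →
      (∀ e → covers L e ≡ true ⊎ inside S e ≡ true → covers U e ≡ true) ×
      (∀ e → covers L e ≡ true → inside S e ≡ true → covers I e ≡ true) ×
      ∑ᴸ U f + ∑ᴸ I f ≤ ∑ᴸ L f + f S
    insert [] S = (S ∷ []) , [] , (λ { e (inj₂ p) → ∨-introˡ p }) , (λ _ ()) , ≤-reflexive (arith (f S))
      where
      arith : ∀ s → s + 0 + 0 ≡ s
      arith = solve-∀
    insert (T ∷ L) S with any? (λ e → (inside T e ∧ inside S e) ≟ᵇ true)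
    ... | no disjoint with insert L S
    ... | U , I , cov∪ , cov∩ , cost = T ∷ U , I , cov∪′ , cov∩′ , cost′
      where
      cov∪′ : ∀ e → covers (T ∷ L) e ≡ true ⊎ inside S e ≡ true → covers (T ∷ U) e ≡ true
      cov∪′ e (inj₂ p) = ∨-introʳ {inside T e} (cov∪ e (inj₂ p))
      cov∪′ e (inj₁ p) with ∨-true {inside T e} p
      ... | inj₁ q = ∨-introˡ q
      ... | inj₂ q = ∨-introʳ {inside T e} (cov∪ e (inj₁ q))
      cov∩′ : ∀ e → covers (T ∷ L) e ≡ true → inside S e ≡ true → covers I e ≡ true
      cov∩′ e p s with ∨-true {inside T e} p
      ... | inj₁ q = absurd (disjoint (e , ∧-intro q s))
      ... | inj₂ q = cov∩ e q s
      cost′ : f T + ∑ᴸ U f + ∑ᴸ I f ≤ f T + ∑ᴸ L f + f S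
      cost′ = subst₂ _≤_ (sym (+-assoc (f T) _ _)) (sym (+-assoc (f T) _ _)) (+-monoʳ-≤ (f T) cost)
    insert (T ∷ L) S | yes (e₀ , meet) with insert L (T ∪ S)
    ... | U , I , cov∪ , cov∩ , cost = U , T ∩ S ∷ I , cov∪′ , cov∩′ , cost′
      where
      cov∪′ : ∀ e → covers (T ∷ L) e ≡ true ⊎ inside S e ≡ true → covers U e ≡ true
      cov∪′ e (inj₂ p) = cov∪ e (inj₂ (inside-∪ʳ T S e p))
      cov∪′ e (inj₁ p) with ∨-true {inside T e} p
      ... | inj₁ q = cov∪ e (inj₂ (inside-∪ˡ T S e q))
      ... | inj₂ q = cov∪ e (inj₁ q)
      cov∩′ : ∀ e → covers (T ∷ L) e ≡ true → inside S e ≡ true → covers (T ∩ S ∷ I) e ≡ true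
      cov∩′ e p s with ∨-true {inside T e} p
      ... | inj₁ q = ∨-introˡ (inside-∩ T S e q s)
      ... | inj₂ q = ∨-introʳ {inside (T ∩ S) e} (cov∩ e q (inside-∪ʳ T S e s))
      sub : f (T ∩ S) + f (T ∪ S) ≤ f T + f S
      sub = submod T S (inside⇒2≤card (T ∩ S) e₀ (inside-∩ T S e₀ (proj₁ (∧-true {inside T e₀} meet)) (proj₂ (∧-true {inside T e₀} meet))))
      arith₁ : ∀ x y z → x + (y + z) ≡ y + (x + z)
      arith₁ = solve-∀
      arith₂ : ∀ l t s → l + (t + s) ≡ t + l + s
      arith₂ = solve-∀
      cost′ : ∑ᴸ U f + (f (T ∩ S) + ∑ᴸ I f) ≤ f T + ∑ᴸ L f + f S
      cost′ = begin
        ∑ᴸ U f + (f (T ∩ S) + ∑ᴸ I f)         ≡⟨ arith₁ (∑ᴸ U f) (f (T ∩ S)) (∑ᴸ I f) ⟩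
        f (T ∩ S) + (∑ᴸ U f + ∑ᴸ I f)         ≤⟨ +-monoʳ-≤ (f (T ∩ S)) cost ⟩
        f (T ∩ S) + (∑ᴸ L f + f (T ∪ S))      ≡⟨ arith₁ (f (T ∩ S)) (∑ᴸ L f) (f (T ∪ S)) ⟩
        ∑ᴸ L f + (f (T ∩ S) + f (T ∪ S))      ≤⟨ +-monoʳ-≤ (∑ᴸ L f) sub ⟩
        ∑ᴸ L f + (f T + f S)                  ≡⟨ arith₂ (∑ᴸ L f) (f T) (f S) ⟩
        f T + ∑ᴸ L f + f S                    ∎
        where open ≤-Reasoning

    -- The members of `L` are inserted into `K` one by one. An edge covered on both sides is caught
    -- by the intersections of the insertion of its member of `L`, because the growing family never
    -- loses an edge covered by `K`.
    uncross : ∀ K L → ∃₂ λ U I →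
      (∀ e → covers K e ≡ true ⊎ covers L e ≡ true → covers U e ≡ true) ×
      (∀ e → covers K e ≡ true → covers L e ≡ true → covers I e ≡ true) ×
      ∑ᴸ U f + ∑ᴸ I f ≤ ∑ᴸ K f + ∑ᴸ L f
    uncross K [] = K , [] , (λ { e (inj₁ p) → p }) , (λ _ _ ()) , ≤-refl
    uncross K (S ∷ L) with insert K S
    ... | K′ , I₁ , cov∪₁ , cov∩₁ , cost₁ with uncross K′ L
    ... | U , I₂ , cov∪₂ , cov∩₂ , cost₂ = U , I₁ ++ I₂ , cov∪ , cov∩ , cost
      where
      cov∪ : ∀ e → covers K e ≡ true ⊎ covers (S ∷ L) e ≡ true → covers U e ≡ true
      cov∪ e (inj₁ p) = cov∪₂ e (inj₁ (cov∪₁ e (inj₁ p)))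
      cov∪ e (inj₂ p) with ∨-true {inside S e} p
      ... | inj₁ q = cov∪₂ e (inj₁ (cov∪₁ e (inj₂ q)))
      ... | inj₂ q = cov∪₂ e (inj₂ q)
      cov∩ : ∀ e → covers K e ≡ true → covers (S ∷ L) e ≡ true → covers (I₁ ++ I₂) e ≡ true
      cov∩ e k p with ∨-true {inside S e} p
      ... | inj₁ q = covers-++ I₁ I₂ e (inj₁ (cov∩₁ e k q))
      ... | inj₂ q = covers-++ I₁ I₂ e (inj₂ (cov∩₂ e (cov∪₁ e (inj₁ k)) q))
      arith₁ : ∀ u i j → u + (i + j) ≡ i + (u + j)
      arith₁ = solve-∀
      arith₂ : ∀ k i l → i + (k + l) ≡ k + i + l
      arith₂ = solve-∀
      cost : ∑ᴸ U f + ∑ᴸ (I₁ ++ I₂) f ≤ ∑ᴸ K f + (f S + ∑ᴸ L f)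
      cost = begin
        ∑ᴸ U f + ∑ᴸ (I₁ ++ I₂) f           ≡⟨ cong (∑ᴸ U f +_) (∑ᴸ-++ I₁ I₂ f) ⟩
        ∑ᴸ U f + (∑ᴸ I₁ f + ∑ᴸ I₂ f)       ≡⟨ arith₁ (∑ᴸ U f) (∑ᴸ I₁ f) (∑ᴸ I₂ f) ⟩
        ∑ᴸ I₁ f + (∑ᴸ U f + ∑ᴸ I₂ f)       ≤⟨ +-monoʳ-≤ (∑ᴸ I₁ f) cost₂ ⟩
        ∑ᴸ I₁ f + (∑ᴸ K′ f + ∑ᴸ L f)       ≡⟨ arith₂ (∑ᴸ K′ f) (∑ᴸ I₁ f) (∑ᴸ L f) ⟩
        ∑ᴸ K′ f + ∑ᴸ I₁ f + ∑ᴸ L f         ≤⟨ +-monoˡ-≤ (∑ᴸ L f) cost₁ ⟩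
        ∑ᴸ K f + f S + ∑ᴸ L f              ≡⟨ +-assoc (∑ᴸ K f) (f S) (∑ᴸ L f) ⟩
        ∑ᴸ K f + (f S + ∑ᴸ L f)            ∎
        where open ≤-Reasoning

module Colouring (G : Graph) {q : ℕ} (f : Fin q → SetFun (n G)) (submod : ∀ i → Submodular₂ (f i)) where

  open Cover G

  Families : Set
  Families = Fin q → List (Subset (n G))

  cost : Families → ℕ
  cost 𝓕 = ∑ (λ i → ∑ᴸ (𝓕 i) (f i))

  -- Head and tail of a colour list are stored separately so that every edge keeps at least one
  -- colour.
  Choices : Set
  Choices = Fin (m G) → Fin q × List (Fin q)

  covered : Choices → Families → Fin (m G) → Bool
  covered A 𝓕 e = all (λ i → covers (𝓕 i) e) (proj₁ (A e) ∷ proj₂ (A e))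

  -- This is the Hall condition. Whatever colour from its list a covered edge receives, the family
  -- of that colour has a member containing it; hence the condition is necessary for a colouring
  -- with at most `f i X` edges of colour `i` inside each `X`. Once all lists are single colours,
  -- one-member families give back these bounds.
  Feasible : Choices → Set
  Feasible A = ∀ 𝓕 → ∑ (λ e → ⟦ covered A 𝓕 e ⟧) ≤ cost 𝓕

  uncrossFamilies : ∀ 𝓕 𝓖 → ∃₂ λ 𝓤 𝓘 →
    (∀ i e → covers (𝓕 i) e ≡ true ⊎ covers (𝓖 i) e ≡ true → covers (𝓤 i) e ≡ true) ×
    (∀ i e → covers (𝓕 i) e ≡ true → covers (𝓖 i) e ≡ true → covers (𝓘 i) e ≡ true) ×
    cost 𝓤 + cost 𝓘 ≤ cost 𝓕 + cost 𝓖
  uncrossFamilies 𝓕 𝓖 =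
    𝓤 , 𝓘 , (λ i → proj₁ (props i)) , (λ i → proj₁ (proj₂ (props i))) ,
    subst₂ _≤_ (∑-+ _ _) (∑-+ _ _) (∑-mono (λ i → proj₂ (proj₂ (props i))))
    where
    result = λ i → Uncrossing.uncross (f i) (submod i) (𝓕 i) (𝓖 i)
    𝓤 𝓘 : Families
    𝓤 i = proj₁ (result i)
    𝓘 i = proj₁ (proj₂ (result i))
    props = λ i → proj₂ (proj₂ (result i))

  -- Rado's argument: if both parts of the split admitted violating families, uncrossing
  -- them would produce a violating family for A.
  split : ∀ A e₀ {x y ys} → A e₀ ≡ (x , y ∷ ys) → Feasible A →
    ¬ Feasible (updateAt A e₀ (const (x , []))) → ¬ Feasible (updateAt A e₀ (const (y , ys))) → Empty
  split A e₀ {x} {y} {ys} eq feas no₁ no₂ = no₁ λ 𝓕 → ≮⇒≥ λ viol𝓕 → no₂ λ 𝓖 → ≮⇒≥ λ viol𝓖 → clash 𝓕 𝓖 viol𝓕 viol𝓖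
    where
    A₁ A₂ : Choices
    A₁ = updateAt A e₀ (const (x , []))
    A₂ = updateAt A e₀ (const (y , ys))
    module _ (𝓕 𝓖 : Families) (viol𝓕 : cost 𝓕 < ∑ (λ e → ⟦ covered A₁ 𝓕 e ⟧)) (viol𝓖 : cost 𝓖 < ∑ (λ e → ⟦ covered A₂ 𝓖 e ⟧)) where
      unc = uncrossFamilies 𝓕 𝓖
      𝓤 = proj₁ unc
      𝓘 = proj₁ (proj₂ unc)
      cov∪ = proj₁ (proj₂ (proj₂ unc))
      cov∩ = proj₁ (proj₂ (proj₂ (proj₂ unc)))

      counts : ∀ a b c d δ → (a ≡ true → b ≡ true → 2 ≤ ⟦ c ⟧ + ⟦ d ⟧ + δ) →
        (a ≡ true ⊎ b ≡ true → 1 ≤ ⟦ c ⟧ + ⟦ d ⟧ + δ) → ⟦ a ⟧ + ⟦ b ⟧ ≤ ⟦ c ⟧ + ⟦ d ⟧ + δ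
      counts true  true  c d δ two one = two refl refl
      counts true  false c d δ two one = one (inj₁ refl)
      counts false true  c d δ two one = one (inj₂ refl)
      counts false false c d δ two one = z≤n

      -- Only `e₀` can lose in the uncrossing: covered on both sides, it is surely covered by `𝓤`
      -- for its full list, but perhaps not by `𝓘`. The loss is at most one, while the two
      -- violations together give a surplus of at least two.
      pointwise : ∀ e → ⟦ covered A₁ 𝓕 e ⟧ + ⟦ covered A₂ 𝓖 e ⟧ ≤
        ⟦ covered A 𝓤 e ⟧ + ⟦ covered A 𝓘 e ⟧ + ⟦ does (e₀ ≟ᶠ e) ⟧
      pointwise e with e₀ ≟ᶠ e
      ... | yes refl
        rewrite updateAt-updates e₀ {f = const (x , [])} A | updateAt-updates e₀ {f = const (y , ys)} A | eq
        = counts (covers (𝓕 x) e₀ ∧ true) (covers (𝓖 y) e₀ ∧ all (λ i → covers (𝓖 i) e₀) ys)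
          (all (λ i → covers (𝓤 i) e₀) (x ∷ y ∷ ys)) (all (λ i → covers (𝓘 i) e₀) (x ∷ y ∷ ys)) 1 both (λ _ → m≤n+m 1 _)
        where
        both : covers (𝓕 x) e₀ ∧ true ≡ true → covers (𝓖 y) e₀ ∧ all (λ i → covers (𝓖 i) e₀) ys ≡ true →
          2 ≤ ⟦ all (λ i → covers (𝓤 i) e₀) (x ∷ y ∷ ys) ⟧ + ⟦ all (λ i → covers (𝓘 i) e₀) (x ∷ y ∷ ys) ⟧ + 1
        both p r rewrite cov∪ x e₀ (inj₁ (proj₁ (∧-true {covers (𝓕 x) e₀} p)))
          | all-mono {q = λ i → covers (𝓤 i) e₀} (y ∷ ys) (λ i s → cov∪ i e₀ (inj₂ s)) r = s≤s (m≤n+m 1 _)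
      ... | no e₀≢e
        rewrite updateAt-minimal e e₀ {f = const (x , [])} A (e₀≢e ∘ sym) | updateAt-minimal e e₀ {f = const (y , ys)} A (e₀≢e ∘ sym)
        = counts (all (λ i → covers (𝓕 i) e) xs) (all (λ i → covers (𝓖 i) e) xs)
          (all (λ i → covers (𝓤 i) e) xs) (all (λ i → covers (𝓘 i) e) xs) 0 both one
        where
        xs = proj₁ (A e) ∷ proj₂ (A e)
        both : all (λ i → covers (𝓕 i) e) xs ≡ true → all (λ i → covers (𝓖 i) e) xs ≡ true →
          2 ≤ ⟦ all (λ i → covers (𝓤 i) e) xs ⟧ + ⟦ all (λ i → covers (𝓘 i) e) xs ⟧ + 0
        both p r rewrite all-mono {q = λ i → covers (𝓤 i) e} xs (λ i s → cov∪ i e (inj₁ s)) p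
          | all-mono₂ {r = λ i → covers (𝓘 i) e} xs (λ i → cov∩ i e) p r = ≤-refl
        one : all (λ i → covers (𝓕 i) e) xs ≡ true ⊎ all (λ i → covers (𝓖 i) e) xs ≡ true →
          1 ≤ ⟦ all (λ i → covers (𝓤 i) e) xs ⟧ + ⟦ all (λ i → covers (𝓘 i) e) xs ⟧ + 0
        one (inj₁ p) rewrite all-mono {q = λ i → covers (𝓤 i) e} xs (λ i s → cov∪ i e (inj₁ s)) p = s≤s z≤n
        one (inj₂ p) rewrite all-mono {q = λ i → covers (𝓤 i) e} xs (λ i s → cov∪ i e (inj₂ s)) p = s≤s z≤n

      ∑δ≡1 : ∑ (λ e → ⟦ does (e₀ ≟ᶠ e) ⟧) ≡ 1
      ∑δ≡1 = trans (∑-cong (λ e → sym (*-identityʳ ⟦ does (e₀ ≟ᶠ e) ⟧))) (∑-δ e₀ (const 1))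

      clash : Empty
      clash = <-irrefl refl (begin-strict
        cost 𝓕 + cost 𝓖 + 1                                      <⟨ ≤-reflexive (arith (cost 𝓕) (cost 𝓖)) ⟩
        suc (cost 𝓕) + suc (cost 𝓖)                              ≤⟨ +-mono-≤ viol𝓕 viol𝓖 ⟩
        ∑ (λ e → ⟦ covered A₁ 𝓕 e ⟧) + ∑ (λ e → ⟦ covered A₂ 𝓖 e ⟧) ≡⟨ ∑-+ _ _ ⟨
        ∑ (λ e → ⟦ covered A₁ 𝓕 e ⟧ + ⟦ covered A₂ 𝓖 e ⟧)          ≤⟨ ∑-mono pointwise ⟩
        ∑ (λ e → ⟦ covered A 𝓤 e ⟧ + ⟦ covered A 𝓘 e ⟧ + ⟦ does (e₀ ≟ᶠ e) ⟧)
          ≡⟨ trans (∑-+ _ _) (cong₂ _+_ (∑-+ _ _) ∑δ≡1) ⟩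
        ∑ (λ e → ⟦ covered A 𝓤 e ⟧) + ∑ (λ e → ⟦ covered A 𝓘 e ⟧) + 1 ≤⟨ +-monoˡ-≤ 1 (+-mono-≤ (feas 𝓤) (feas 𝓘)) ⟩
        cost 𝓤 + cost 𝓘 + 1                                      ≤⟨ +-monoˡ-≤ 1 (proj₂ (proj₂ (proj₂ (proj₂ unc)))) ⟩
        cost 𝓕 + cost 𝓖 + 1                                      ∎)
        where
        open ≤-Reasoning
        arith : ∀ a b → suc (a + b + 1) ≡ suc a + suc b
        arith = solve-∀

  spare : Choices → ℕ
  spare A = ∑ (λ e → length (proj₂ (A e)))

  spare-update : ∀ A e₀ {x y ys z zs} → A e₀ ≡ (x , y ∷ ys) → length zs ≤ length ys →
    spare (updateAt A e₀ (const (z , zs))) < spare A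
  spare-update A e₀ {x} {y} {ys} {z} {zs} eq zs≤ys =
    subst (_≤ spare A) (trans (∑-+ _ _) (cong (_+ spare A′) (∑-δ e₀ (const 1)))) (∑-mono pointwise)
    where
    A′ = updateAt A e₀ (const (z , zs))
    pointwise : ∀ e → ⟦ does (e₀ ≟ᶠ e) ⟧ * 1 + length (proj₂ (A′ e)) ≤ length (proj₂ (A e))
    pointwise e with e₀ ≟ᶠ e
    ... | yes refl rewrite updateAt-updates e₀ {f = const (z , zs)} A | eq = s≤s zs≤ys
    ... | no e₀≢e rewrite updateAt-minimal e e₀ {f = const (z , zs)} A (e₀≢e ∘ sym) = ≤-refl

  -- Induction on `spare`: while some list has two colours, `split` says that one of the two ways to
  -- shorten it preserves feasibility. Feasibility quantifies over all families and is not decided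
  -- here, so it remains open which way works, whence the double negation. `Allowed` remembers the
  -- original lists.
  colour : (Allowed : Fin (m G) → Fin q → Set) → ∀ A → (∀ e → All (Allowed e) (proj₁ (A e) ∷ proj₂ (A e))) → Feasible A →
    ¬ ¬ (∃ λ (c : Fin (m G) → Fin q) → (∀ e → Allowed e (c e)) × Feasible (λ e → c e , []))
  colour Allowed A = go A (<-wellFounded (spare A))
    where
    Goal = ∃ λ (c : Fin (m G) → Fin q) → (∀ e → Allowed e (c e)) × Feasible (λ e → c e , [])
    AllowedBy : Choices → Set
    AllowedBy A = ∀ e → All (Allowed e) (proj₁ (A e) ∷ proj₂ (A e))

    allowed-update : ∀ {A} e₀ {z zs} → AllowedBy A → All (Allowed e₀) (z ∷ zs) → AllowedBy (updateAt A e₀ (const (z , zs)))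
    allowed-update {A} e₀ {z} {zs} all₀ new e with e₀ ≟ᶠ e
    ... | yes refl rewrite updateAt-updates e₀ {f = const (z , zs)} A = new
    ... | no e₀≢e rewrite updateAt-minimal e e₀ {f = const (z , zs)} A (e₀≢e ∘ sym) = all₀ e

    head-allowed : ∀ {e x xs} → All (Allowed e) (x ∷ xs) → Allowed e x
    head-allowed (p ∷ _) = p

    go : ∀ A → Acc _<_ (spare A) → AllowedBy A → Feasible A → ¬ ¬ Goal
    go A (acc rec) allowed feas ¬goal with any? (λ e → 0 <? length (proj₂ (A e)))
    ... | no none = ¬goal (proj₁ ∘ A , (λ e → head-allowed (allowed e)) , λ 𝓕 → subst (_≤ cost 𝓕) (∑-cong (same 𝓕)) (feas 𝓕))
      where
      tail-empty : ∀ (xs : List (Fin q)) → ¬ (0 < length xs) → xs ≡ []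
      tail-empty []       _ = refl
      tail-empty (x ∷ xs) p = absurd (p (s≤s z≤n))
      same : ∀ 𝓕 e → ⟦ covered A 𝓕 e ⟧ ≡ ⟦ covered (λ e → proj₁ (A e) , []) 𝓕 e ⟧
      same 𝓕 e rewrite tail-empty (proj₂ (A e)) (λ p → none (e , p)) = refl
    ... | yes (e₀ , long) with A e₀ in eq | allowed e₀
    ... | (x , y ∷ ys) | px ∷ pys =
      split A e₀ eq feas
        (λ feas₁ → go _ (rec (spare-update A e₀ eq z≤n)) (allowed-update e₀ allowed (px ∷ [])) feas₁ ¬goal)
        (λ feas₂ → go _ (rec (spare-update A e₀ eq ≤-refl)) (allowed-update e₀ allowed pys) feas₂ ¬goal)

-- The common shape of the counting steps: the wanted inequality is obtained after adding `c` on
-- both sides, and the two equations leave the rearrangement to the ring solver.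
cancel-≤ : ∀ {x y} c {a b} → x + c ≡ a → a ≤ b → b ≡ y + c → x ≤ y
cancel-≤ {x} {y} c p a≤b q = +-cancelʳ-≤ c x y (subst₂ _≤_ (sym p) q a≤b)

-- Set functions and multiplicities

-- Partitions are handled through this function: a list is a partition, possibly with empty members,
-- when all multiplicities are 1.
mult : ∀ {k} → List (Subset k) → Fin k → ℕ
mult P v = ∑ᴸ P (λ Y → ⟦ lookup Y v ⟧)

mult-⋃ : ∀ {k} (P : List (Subset k)) v → lookup (⋃ P) v ≡ true → 1 ≤ mult P v
mult-⋃ []      v p = absurd (true≢false p (lookup-⊥ v))
mult-⋃ (Y ∷ P) v p with ∪-elim Y (⋃ P) p
... | inj₁ q rewrite q = s≤s z≤n
... | inj₂ q = ≤-trans (mult-⋃ P v q) (m≤n+m _ _)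

⋃-mult : ∀ {k} (P : List (Subset k)) v → 1 ≤ mult P v → lookup (⋃ P) v ≡ true
⋃-mult (Y ∷ P) v p with lookup Y v in eq
... | true  = ∪-introˡ Y (⋃ P) eq
... | false = ∪-introʳ Y (⋃ P) (⋃-mult P v p)

mult-singletons : ∀ {k} (v : Fin k) → mult (List.tabulate ⁅_⁆) v ≡ 1
mult-singletons v = trans (∑ᴸ-tabulate ⁅_⁆ _) (trans (∑-cong λ u → trans (cong ⟦_⟧ (lookup-⁅⁆ u v)) (sym (*-identityʳ _))) (∑-δ v (const 1)))

module _ {k : ℕ} (h : SetFun k) where

  sumPt≡∑ : ∀ X → sumPt h X ≡ ∑ (λ v → ⟦ lookup X v ⟧ * pt h v)
  sumPt≡∑ X = sumOver≡∑ X (pt h)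

  sumPt-⁅⁆ : ∀ v → sumPt h ⁅ v ⁆ ≡ pt h v
  sumPt-⁅⁆ v = trans (sumPt≡∑ ⁅ v ⁆) (trans (∑-cong λ u → cong (λ b → ⟦ b ⟧ * pt h u) (trans (lookup-⁅⁆ v u) (≟-sym u v))) (∑-δ v (pt h)))
    where
    ≟-sym : ∀ {j} (u v : Fin j) → does (u ≟ᶠ v) ≡ does (v ≟ᶠ u)
    ≟-sym zero    zero    = refl
    ≟-sym zero    (suc v) = refl
    ≟-sym (suc u) zero    = refl
    ≟-sym (suc u) (suc v) = ≟-sym u v

  sumPt-⊥ : sumPt h ⊥ ≡ 0
  sumPt-⊥ = trans (sumPt≡∑ ⊥) (∑-zero λ v → cong (λ b → ⟦ b ⟧ * pt h v) (lookup-⊥ v))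

  ∑ᴸ-sumPt : ∀ L → ∑ᴸ L (sumPt h) ≡ ∑ (λ v → mult L v * pt h v)
  ∑ᴸ-sumPt L = trans (∑ᴸ-cong L sumPt≡∑) (trans (∑ᴸ-∑-comm L _) (∑-cong λ v → sym (∑ᴸ-*ʳ L (pt h v) _)))

  ∑ᴸ-sumPt-∩ : ∀ L Z → ∑ᴸ L (λ X → sumPt h (X ∩ Z)) ≡ ∑ (λ v → mult L v * (⟦ lookup Z v ⟧ * pt h v))
  ∑ᴸ-sumPt-∩ L Z = trans (∑ᴸ-cong L λ X → trans (sumPt≡∑ (X ∩ Z)) (∑-cong (weight X)))
    (trans (∑ᴸ-∑-comm L _) (∑-cong λ v → sym (∑ᴸ-*ʳ L (⟦ lookup Z v ⟧ * pt h v) _)))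
    where
    ⟦∧⟧ : ∀ a b x → ⟦ a ∧ b ⟧ * x ≡ ⟦ a ⟧ * (⟦ b ⟧ * x)
    ⟦∧⟧ true  b x = sym (*-identityˡ (⟦ b ⟧ * x))
    ⟦∧⟧ false b x = refl
    weight : ∀ X v → ⟦ lookup (X ∩ Z) v ⟧ * pt h v ≡ ⟦ lookup X v ⟧ * (⟦ lookup Z v ⟧ * pt h v)
    weight X v = trans (cong (λ b → ⟦ b ⟧ * pt h v) (lookup-∩ X Z v)) (⟦∧⟧ (lookup X v) (lookup Z v) (pt h v))

  sumPt-modular : ∀ A B → sumPt h (A ∩ B) + sumPt h (A ∪ B) ≡ sumPt h A + sumPt h B
  sumPt-modular A B = begin
    sumPt h (A ∩ B) + sumPt h (A ∪ B)  ≡⟨ cong₂ _+_ (sumPt≡∑ (A ∩ B)) (sumPt≡∑ (A ∪ B)) ⟩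
    ∑ (λ v → ⟦ lookup (A ∩ B) v ⟧ * pt h v) + ∑ (λ v → ⟦ lookup (A ∪ B) v ⟧ * pt h v) ≡⟨ ∑-+ _ _ ⟨
    ∑ (λ v → ⟦ lookup (A ∩ B) v ⟧ * pt h v + ⟦ lookup (A ∪ B) v ⟧ * pt h v) ≡⟨ ∑-cong pointwise ⟩
    ∑ (λ v → ⟦ lookup A v ⟧ * pt h v + ⟦ lookup B v ⟧ * pt h v) ≡⟨ ∑-+ _ _ ⟩
    ∑ (λ v → ⟦ lookup A v ⟧ * pt h v) + ∑ (λ v → ⟦ lookup B v ⟧ * pt h v) ≡⟨ cong₂ _+_ (sumPt≡∑ A) (sumPt≡∑ B) ⟨
    sumPt h A + sumPt h B ∎
    where
    open ≡-Reasoning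
    bool : ∀ a b x → ⟦ a ∧ b ⟧ * x + ⟦ a ∨ b ⟧ * x ≡ ⟦ a ⟧ * x + ⟦ b ⟧ * x
    bool true  true  x = refl
    bool true  false x = +-comm 0 (1 * x)
    bool false b     x = refl
    pointwise : ∀ v → ⟦ lookup (A ∩ B) v ⟧ * pt h v + ⟦ lookup (A ∪ B) v ⟧ * pt h v ≡ ⟦ lookup A v ⟧ * pt h v + ⟦ lookup B v ⟧ * pt h v
    pointwise v rewrite lookup-∩ A B v | lookup-∪ A B v = bool (lookup A v) (lookup B v) (pt h v)

  -- The functions f and g of the overview, for `ℓ` and `l`. For subadditive `h` the truncated
  -- subtraction is exact, by `≤sumPt` below.
  defect : SetFun k
  defect X = sumPt h X ∸ h X

  module SubadditiveFunction (h⊥ : ZeroOnEmpty h) (sub : Subadditive h) where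

    -- Subadditivity splits off one member of `P` at a time; multiplicities of at most 1 make the
    -- pieces disjoint.
    ≤∑-∩⋃ : ∀ P X → (∀ v → mult P v ≤ 1) → h (X ∩ ⋃ P) ≤ ∑ᴸ P (λ Y → h (X ∩ Y))
    ≤∑-∩⋃ []      X _ = ≤-reflexive (trans (cong h (∩-zeroʳ X)) h⊥)
    ≤∑-∩⋃ (Y ∷ P) X ≤1 = begin
      h (X ∩ (Y ∪ ⋃ P))             ≡⟨ cong h (∩-distribˡ-∪ X Y (⋃ P)) ⟩
      h ((X ∩ Y) ∪ (X ∩ ⋃ P))       ≤⟨ sub (X ∩ Y) (X ∩ ⋃ P) disjoint ⟩
      h (X ∩ Y) + h (X ∩ ⋃ P)       ≤⟨ +-monoʳ-≤ _ (≤∑-∩⋃ P X λ v → ≤-trans (m≤n+m _ _) (≤1 v)) ⟩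
      h (X ∩ Y) + ∑ᴸ P (λ Y → h (X ∩ Y)) ∎
      where
      open ≤-Reasoning
      disjoint : (X ∩ Y) ∩ (X ∩ ⋃ P) ≡ ⊥
      disjoint = empty-ext λ v p →
        let (xy , xp) = ∩-elim (X ∩ Y) (X ∩ ⋃ P) p in
        clash v (proj₂ (∩-elim X Y xy)) (mult-⋃ P v (proj₂ (∩-elim X (⋃ P) xp)))
        where
        clash : ∀ v → lookup Y v ≡ true → 1 ≤ mult P v → Empty
        clash v y p = <-irrefl refl (≤-trans (≤-trans (s≤s p) (≤-reflexive (cong (λ b → ⟦ b ⟧ + mult P v) (sym y)))) (≤1 v))

    ≤∑-∩ : ∀ P X → (∀ v → mult P v ≡ 1) → h X ≤ ∑ᴸ P (λ Y → h (X ∩ Y))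
    ≤∑-∩ P X ≡1 = subst (λ Z → h Z ≤ ∑ᴸ P (λ Y → h (X ∩ Y))) X∩⋃P≡X (≤∑-∩⋃ P X (≤-reflexive ∘ ≡1))
      where
      X∩⋃P≡X : X ∩ ⋃ P ≡ X
      X∩⋃P≡X = trans (cong (X ∩_) (subset-ext λ v → trans (⋃-mult P v (≤-reflexive (sym (≡1 v)))) (sym (lookup-⊤ v)))) (∩-identityʳ X)

    ≤sumPt : ∀ X → h X ≤ sumPt h X
    ≤sumPt X = begin
      -- The partition into singletons turns the sum over parts into the sum over vertices.
      h X                                            ≤⟨ ≤∑-∩ (List.tabulate ⁅_⁆) X mult-singletons ⟩
      ∑ᴸ (List.tabulate ⁅_⁆) (λ Y → h (X ∩ Y))        ≡⟨ ∑ᴸ-tabulate ⁅_⁆ _ ⟩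
      ∑ (λ v → h (X ∩ ⁅ v ⁆))                         ≡⟨ ∑-cong pointwise ⟩
      ∑ (λ v → ⟦ lookup X v ⟧ * pt h v)               ≡⟨ sumPt≡∑ X ⟨
      sumPt h X                                      ∎
      where
      open ≤-Reasoning
      ∩⁅⁆ : ∀ u v → lookup (X ∩ ⁅ v ⁆) u ≡ true → u ≡ v × lookup X v ≡ true
      ∩⁅⁆ u v p with ∩-elim X ⁅ v ⁆ p
      ... | xu , vu with u ≟ᶠ v | trans (sym (lookup-⁅⁆ v u)) vu
      ... | yes refl | _ = refl , xu
      pointwise : ∀ v → h (X ∩ ⁅ v ⁆) ≡ ⟦ lookup X v ⟧ * pt h v
      pointwise v with lookup X v in eq
      ... | false = trans (cong h (empty-ext λ u p → true≢false (proj₂ (∩⁅⁆ u v p)) eq)) h⊥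
      ... | true  = trans (cong h (subset-ext same)) (sym (*-identityˡ (pt h v)))
        where
        same : ∀ u → lookup (X ∩ ⁅ v ⁆) u ≡ lookup ⁅ v ⁆ u
        same u with lookup ⁅ v ⁆ u in eq′ | lookup (X ∩ ⁅ v ⁆) u in eq″
        ... | false | true  = absurd (true≢false (proj₂ (∩-elim X ⁅ v ⁆ eq″)) eq′)
        ... | false | false = refl
        ... | true  | true  = refl
        ... | true  | false with u ≟ᶠ v | trans (sym (lookup-⁅⁆ v u)) eq′
        ... | yes refl | _ = absurd (true≢false (∩-intro X ⁅ u ⁆ eq eq′) eq″)

    defect+ : ∀ X → defect X + h X ≡ sumPt h X
    defect+ X = m∸n+n≡m (≤sumPt X)

    ∑ᴸ-defect+ : ∀ L → ∑ᴸ L defect + ∑ᴸ L h ≡ ∑ᴸ L (sumPt h)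
    ∑ᴸ-defect+ L = trans (sym (∑ᴸ-+ L defect h)) (∑ᴸ-cong L defect+)

    defect-⁅⁆ : ∀ v → defect ⁅ v ⁆ ≡ 0
    defect-⁅⁆ v = trans (cong (_∸ pt h v) (sumPt-⁅⁆ v)) (n∸n≡0 (pt h v))

    -- The vertex sum is modular, so subtracting a supermodular function leaves a submodular one.
    defect-submodular : ∀ {c} → IntersectingSupermodular c h → ∀ A B → c ≤ ∣ A ∩ B ∣ →
      defect (A ∩ B) + defect (A ∪ B) ≤ defect A + defect B
    defect-submodular super A B c≤ = cancel-≤ (h (A ∩ B) + h (A ∪ B)) {a = defect A + defect B + (h A + h B)}
      eq (+-monoʳ-≤ (defect A + defect B) (super A B c≤)) refl
      where
      rearrange : ∀ a b c d → a + b + (c + d) ≡ (a + c) + (b + d)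
      rearrange = solve-∀
      eq : defect (A ∩ B) + defect (A ∪ B) + (h (A ∩ B) + h (A ∪ B)) ≡ defect A + defect B + (h A + h B)
      eq = begin
        defect (A ∩ B) + defect (A ∪ B) + (h (A ∩ B) + h (A ∪ B)) ≡⟨ rearrange (defect (A ∩ B)) _ _ _ ⟩
        (defect (A ∩ B) + h (A ∩ B)) + (defect (A ∪ B) + h (A ∪ B)) ≡⟨ cong₂ _+_ (defect+ (A ∩ B)) (defect+ (A ∪ B)) ⟩
        sumPt h (A ∩ B) + sumPt h (A ∪ B) ≡⟨ sumPt-modular A B ⟩
        sumPt h A + sumPt h B ≡⟨ cong₂ _+_ (defect+ A) (defect+ B) ⟨
        (defect A + h A) + (defect B + h B) ≡⟨ rearrange (defect A) _ _ _ ⟨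
        defect A + defect B + (h A + h B) ∎
        where open ≡-Reasoning

    -- The vertex sum of `X` splits exactly along the partition, while the values of `h` on the
    -- pieces add up to at least `h X`. This allows the sets of colour f to be cut along the parts
    -- at no extra cost.
    ∑-defect-∩ : ∀ P X → (∀ v → mult P v ≡ 1) → ∑ᴸ P (λ Y → defect (X ∩ Y)) ≤ defect X
    ∑-defect-∩ P X ≡1 = cancel-≤ (∑ᴸ P (λ Y → h (X ∩ Y))) {a = defect X + h X} eq (+-monoʳ-≤ (defect X) (≤∑-∩ P X ≡1)) refl
      where
      open ≡-Reasoning
      eq : ∑ᴸ P (λ Y → defect (X ∩ Y)) + ∑ᴸ P (λ Y → h (X ∩ Y)) ≡ defect X + h X
      eq = begin
        ∑ᴸ P (λ Y → defect (X ∩ Y)) + ∑ᴸ P (λ Y → h (X ∩ Y)) ≡⟨ ∑ᴸ-+ P _ _ ⟨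
        ∑ᴸ P (λ Y → defect (X ∩ Y) + h (X ∩ Y)) ≡⟨ ∑ᴸ-cong P (λ Y → trans (defect+ (X ∩ Y)) (cong (sumPt h) (∩-comm X Y))) ⟩
        ∑ᴸ P (λ Y → sumPt h (Y ∩ X)) ≡⟨ ∑ᴸ-sumPt-∩ P X ⟩
        ∑ (λ v → mult P v * (⟦ lookup X v ⟧ * pt h v)) ≡⟨ ∑-cong (λ v → trans (cong (_* (⟦ lookup X v ⟧ * pt h v)) (≡1 v)) (*-identityˡ _)) ⟩
        ∑ (λ v → ⟦ lookup X v ⟧ * pt h v) ≡⟨ sumPt≡∑ X ⟨
        sumPt h X ≡⟨ defect+ X ⟨
        defect X + h X ∎

nonincreasing⇒subadditive : ∀ {k} (h : SetFun k) → Nonincreasing h → Subadditive h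
nonincreasing⇒subadditive h dec A B _ with nonempty? A
... | yes ne = ≤-trans (dec A (A ∪ B) ne (p⊆p∪q B)) (m≤m+n _ _)
... | no  e  = ≤-trans (≤-reflexive (cong h (trans (cong (_∪ B) (empty⇒≡⊥ A e)) (∪-identityˡ B)))) (m≤n+m _ _)

-- Merging an intersecting family into a partition

module Merging (G : Graph) (g : SetFun (n G)) (g-⁅⁆ : ∀ v → g ⁅ v ⁆ ≡ 0)
  (submod : ∀ A B → 1 ≤ ∣ A ∩ B ∣ → g (A ∩ B) + g (A ∪ B) ≤ g A + g B) where

  open Cover G

  -- Every member that shares a vertex with the growing set is absorbed, and the term of the
  -- intersection is dropped because costs are nonnegative. The maximum in the multiplicities says
  -- that the members remain disjoint while their union gains `S`.
  mergeInto : ∀ U S → (∀ v → mult U v ≤ 1) → ∃ λ U′ →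
    (∀ v → mult U′ v ≡ mult U v ⊔ ⟦ lookup S v ⟧) ×
    (∀ e → covers U e ≡ true ⊎ inside S e ≡ true → covers U′ e ≡ true) ×
    ∑ᴸ U′ g ≤ ∑ᴸ U g + g S
  mergeInto [] S _ = (S ∷ []) , (λ v → +-identityʳ _) , (λ { e (inj₂ p) → ∨-introˡ p }) , ≤-reflexive (+-identityʳ _)
  mergeInto (T ∷ U) S ≤1 with nonempty? (T ∩ S)
  ... | no disjoint with mergeInto U S (λ v → ≤-trans (m≤n+m _ _) (≤1 v))
  ... | U′ , mult-U′ , cov , cost = T ∷ U′ , mult-TU′ , cov′ , cost′
    where
    mult-TU′ : ∀ v → ⟦ lookup T v ⟧ + mult U′ v ≡ (⟦ lookup T v ⟧ + mult U v) ⊔ ⟦ lookup S v ⟧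
    mult-TU′ v with lookup T v in eqT | lookup S v in eqS | mult-U′ v | ≤1 v
    ... | true  | true  | _ | _ = absurd (disjoint (v , lookup⇒[]= v (T ∩ S) (∩-intro T S eqT eqS)))
    ... | true  | false | p | s≤s q rewrite p | n≤0⇒n≡0 q = refl
    ... | false | true  | p | _ rewrite p = refl
    ... | false | false | p | _ rewrite p = refl
    cov′ : ∀ e → covers (T ∷ U) e ≡ true ⊎ inside S e ≡ true → covers (T ∷ U′) e ≡ true
    cov′ e (inj₂ p) = ∨-introʳ {inside T e} (cov e (inj₂ p))
    cov′ e (inj₁ p) with ∨-true {inside T e} p
    ... | inj₁ q = ∨-introˡ q
    ... | inj₂ q = ∨-introʳ {inside T e} (cov e (inj₁ q))
    cost′ : g T + ∑ᴸ U′ g ≤ g T + ∑ᴸ U g + g S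
    cost′ = subst (g T + ∑ᴸ U′ g ≤_) (sym (+-assoc (g T) _ _)) (+-monoʳ-≤ (g T) cost)
  mergeInto (T ∷ U) S ≤1 | yes (u , u∈) with mergeInto U (T ∪ S) (λ v → ≤-trans (m≤n+m _ _) (≤1 v))
  ... | U′ , mult-U′ , cov , cost = U′ , mult-TU′ , cov′ , cost′
    where
    bool : ∀ t s x → ⟦ t ⟧ + x ≤ 1 → x ⊔ ⟦ t ∨ s ⟧ ≡ (⟦ t ⟧ + x) ⊔ ⟦ s ⟧
    bool true  true  x (s≤s q) rewrite n≤0⇒n≡0 q = refl
    bool true  false x (s≤s q) rewrite n≤0⇒n≡0 q = refl
    bool false s     x _ = refl
    mult-TU′ : ∀ v → mult U′ v ≡ (⟦ lookup T v ⟧ + mult U v) ⊔ ⟦ lookup S v ⟧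
    mult-TU′ v = trans (mult-U′ v) (trans (cong (λ b → mult U v ⊔ ⟦ b ⟧) (lookup-∪ T S v)) (bool (lookup T v) (lookup S v) (mult U v) (≤1 v)))
    cov′ : ∀ e → covers (T ∷ U) e ≡ true ⊎ inside S e ≡ true → covers U′ e ≡ true
    cov′ e (inj₂ p) = cov e (inj₂ (inside-∪ʳ T S e p))
    cov′ e (inj₁ p) with ∨-true {inside T e} p
    ... | inj₁ q = cov e (inj₂ (inside-∪ˡ T S e q))
    ... | inj₂ q = cov e (inj₁ q)
    rearrange : ∀ u t s → u + (t + s) ≡ t + u + s
    rearrange = solve-∀
    cost′ : ∑ᴸ U′ g ≤ g T + ∑ᴸ U g + g S
    cost′ = begin
      ∑ᴸ U′ g                ≤⟨ cost ⟩
      ∑ᴸ U g + g (T ∪ S)     ≤⟨ +-monoʳ-≤ (∑ᴸ U g) (≤-trans (m≤n+m _ (g (T ∩ S))) (submod T S (≤-trans (s≤s z≤n) (x∈p⇒∣p-x∣<∣p∣ u∈)))) ⟩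
      ∑ᴸ U g + (g T + g S)   ≡⟨ rearrange (∑ᴸ U g) (g T) (g S) ⟩
      g T + ∑ᴸ U g + g S     ∎
      where open ≤-Reasoning

  -- Starting from the singletons, which cost nothing, makes the result cover every vertex; merging
  -- preserves this.
  mergeAll : ∀ L → ∃ λ P → (∀ v → mult P v ≡ 1) × (∀ e → covers L e ≡ true → covers P e ≡ true) × ∑ᴸ P g ≤ ∑ᴸ L g
  mergeAll [] = List.tabulate ⁅_⁆ , mult-singletons , (λ _ ()) ,
    ≤-reflexive (trans (∑ᴸ-tabulate ⁅_⁆ g) (∑-zero g-⁅⁆))
  mergeAll (S ∷ L) with mergeAll L
  ... | P , mult-P , cov , cost with mergeInto P S (≤-reflexive ∘ mult-P)
  ... | P′ , mult-P′ , cov′ , cost′ = P′ , mult≡1 , cov″ , ≤-trans cost′ (≤-trans (+-monoˡ-≤ (g S) cost) (≤-reflexive (+-comm _ (g S))))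
    where
    mult≡1 : ∀ v → mult P′ v ≡ 1
    mult≡1 v = trans (mult-P′ v) (trans (cong (_⊔ ⟦ lookup S v ⟧) (mult-P v)) (m≥n⇒m⊔n≡m (⟦⟧≤1 (lookup S v))))
    cov″ : ∀ e → covers (S ∷ L) e ≡ true → covers P′ e ≡ true
    cov″ e p with ∨-true {inside S e} p
    ... | inj₁ q = cov′ e (inj₂ q)
    ... | inj₂ q = cov′ e (inj₁ (cov e q))

-- Uncovered edge ends at vertices of low multiplicity

isZero atLeastTwo : ℕ → Bool
isZero zero    = true
isZero (suc _) = false
atLeastTwo (suc (suc _)) = true
atLeastTwo _             = false

≢⊤⇒⊂⊤ : ∀ {k} (X : Subset k) → X ≢ ⊤ → X ⊂ ⊤
≢⊤⇒⊂⊤ X X≢⊤ with any? (λ v → lookup X v ≟ᵇ false)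
... | yes (v , p) = (λ {u} _ → lookup⇒[]= u ⊤ (lookup-⊤ u)) , v , lookup⇒[]= v ⊤ (lookup-⊤ v) , λ v∈X → true≢false ([]=⇒lookup v∈X) p
... | no none = absurd (X≢⊤ (subset-ext λ v → trans (all-true v) (sym (lookup-⊤ v))))
  where
  all-true : ∀ v → lookup X v ≡ true
  all-true v with lookup X v in eq
  ... | true  = refl
  ... | false = absurd (none (v , eq))

_⊑_ : ∀ {k} → Subset k → Subset k → Set
X ⊑ Y = ∀ v → lookup X v ≡ true → lookup Y v ≡ true

⊑⇒⊆ : ∀ {k} {X Y : Subset k} → X ⊑ Y → X ⊆ Y
⊑⇒⊆ {Y = Y} p {v} v∈X = lookup⇒[]= v Y (p v ([]=⇒lookup v∈X))

⁅⁆⊑ : ∀ {k} {v} {Y : Subset k} → lookup Y v ≡ true → ⁅ v ⁆ ⊑ Y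
⁅⁆⊑ {v = v} p u q with u ≟ᶠ v | trans (sym (lookup-⁅⁆ v u)) q
... | yes refl | _ = p

≤∑ᴸ-member : ∀ {k} {P : Subset k → Set} {L} {F : Subset k → ℕ} {c} v → All P L → 1 ≤ mult L v →
  (∀ X → P X → lookup X v ≡ true → c ≤ F X) → c ≤ ∑ᴸ L F
≤∑ᴸ-member {L = X ∷ L} v (px ∷ pL) p q with lookup X v in eq
... | true  = ≤-trans (q X px eq) (m≤m+n _ _)
... | false = ≤-trans (≤∑ᴸ-member v pL p q) (m≤n+m _ _)

mult-⊑ : ∀ {k} {Y : Subset k} {L v} → All (_⊑ Y) L → 1 ≤ mult L v → lookup Y v ≡ true
mult-⊑ {Y = Y} {X ∷ L} {v} (X⊑Y ∷ L⊑Y) p with lookup X v in eq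
... | true  = X⊑Y v eq
... | false = mult-⊑ {Y = Y} L⊑Y p

module HalfEdges (G : Graph) where

  open Cover G

  covers⇒1≤∑ : ∀ L e → covers L e ≡ true → 1 ≤ ∑ᴸ L (λ X → ⟦ inside X e ⟧)
  covers⇒1≤∑ (X ∷ L) e p with inside X e
  ... | true  = s≤s z≤n
  ... | false = covers⇒1≤∑ L e p

  ends-covered : ∀ {Y} L e → All (_⊑ Y) L → covers L e ≡ true → inside Y e ≡ true
  ends-covered {Y} (X ∷ L) e (X⊑Y ∷ L⊑Y) p with ∨-true {inside X e} p
  ... | inj₁ q = ∧-intro (X⊑Y _ (proj₁ (ends-inside X e q))) (X⊑Y _ (proj₂ (ends-inside X e q)))
  ... | inj₂ q = ends-covered {Y} L e L⊑Y q

  -- Ends are counted instead of edges: an uncovered edge counts twice inside `Y` and once when it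
  -- leaves `Y`. Over a partition each edge thus counts at most twice, which explains the factors 2
  -- in the bounds that follow.
  halfEdges : List (Subset (n G)) → Subset (n G) → ℕ
  halfEdges L Y = ∑ (λ e → ⟦ not (covers L e) ⟧ * (⟦ lookup Y (end₁ G e) ⟧ + ⟦ lookup Y (end₂ G e) ⟧))

  ∑-degree≤ : ∀ (w : Fin (n G) → ℕ) → ∑ (λ v → w v * degree G v) ≤ ∑ (λ e → w (end₁ G e) + w (end₂ G e))
  ∑-degree≤ w = begin
    ∑ (λ v → w v * degree G v)
      ≡⟨ ∑-cong (λ v → trans (cong (w v *_) (count≡∑ _)) (∑-*ˡ (w v) _)) ⟩
    ∑ (λ v → ∑ (λ e → w v * ⟦ in₁ G ⁅ v ⁆ e ∨ in₂ G ⁅ v ⁆ e ⟧))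
      ≡⟨ ∑-comm _ ⟩
    ∑ (λ e → ∑ (λ v → w v * ⟦ in₁ G ⁅ v ⁆ e ∨ in₂ G ⁅ v ⁆ e ⟧))
      ≤⟨ ∑-mono (λ e → ∑-mono (pointwise e)) ⟩
    ∑ (λ e → ∑ (λ v → ⟦ does (end₁ G e ≟ᶠ v) ⟧ * w v + ⟦ does (end₂ G e ≟ᶠ v) ⟧ * w v))
      ≡⟨ ∑-cong (λ e → trans (∑-+ _ _) (cong₂ _+_ (∑-δ (end₁ G e) w) (∑-δ (end₂ G e) w))) ⟩
    ∑ (λ e → w (end₁ G e) + w (end₂ G e)) ∎
    where
    open ≤-Reasoning
    bool : ∀ a b x → x * ⟦ a ∨ b ⟧ ≤ ⟦ a ⟧ * x + ⟦ b ⟧ * x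
    bool true  b     x = ≤-trans (≤-reflexive (*-comm x 1)) (m≤m+n _ _)
    bool false true  x = ≤-reflexive (*-comm x 1)
    bool false false x = ≤-reflexive (*-comm x 0)
    pointwise : ∀ e v → w v * ⟦ in₁ G ⁅ v ⁆ e ∨ in₂ G ⁅ v ⁆ e ⟧ ≤ ⟦ does (end₁ G e ≟ᶠ v) ⟧ * w v + ⟦ does (end₂ G e ≟ᶠ v) ⟧ * w v
    pointwise e v rewrite lookup-⁅⁆ v (end₁ G e) | lookup-⁅⁆ v (end₂ G e) = bool (does (end₁ G e ≟ᶠ v)) _ (w v)

  split-mult : ∀ (L : List (Subset (n G))) u w → ∑ᴸ L (λ X → ⟦ lookup X u ∧ not (lookup X w) ⟧) + ∑ᴸ L (λ X → ⟦ lookup X u ∧ lookup X w ⟧) ≡ mult L u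
  split-mult L u w = trans (sym (∑ᴸ-+ L _ _)) (∑ᴸ-cong L λ X → bool (lookup X u) (lookup X w))
    where
    bool : ∀ a b → ⟦ a ∧ not b ⟧ + ⟦ a ∧ b ⟧ ≡ ⟦ a ⟧
    bool true  true  = refl
    bool true  false = refl
    bool false b     = refl

  -- own X and common X are the sets A and B to which the connectivity hypothesis is applied. An edge
  -- of G - B leaving A is uncovered, because its end in A lies in no member of L other than X.
  module Private (Y : Subset (n G)) (L : List (Subset (n G))) (L⊑Y : All (_⊑ Y) L) where

    shared : Subset (n G)
    shared = Vec.tabulate (λ v → atLeastTwo (mult L v))

    lookup-shared : ∀ v → lookup shared v ≡ atLeastTwo (mult L v)
    lookup-shared v = lookup∘tabulate _ v

    own common : Subset (n G) → Subset (n G)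
    own X    = X ∩ ∁ shared
    common X = X ∩ shared

    own∪common : ∀ X → own X ∪ common X ≡ X
    own∪common X = trans (sym (∩-distribˡ-∪ X (∁ shared) shared)) (trans (cong (X ∩_) (∪-inverseˡ shared)) (∩-identityʳ X))

    own∩common : ∀ X → own X ∩ common X ≡ ⊥
    own∩common X = empty-ext λ v p →
      let (o , c) = ∩-elim (own X) (common X) p in
      true≢false (proj₂ (∩-elim X shared c)) (not-true⇒false (trans (sym (lookup-∁ shared v)) (proj₂ (∩-elim X (∁ shared) o))))

    free low : Fin (n G) → ℕ
    free v = ⟦ lookup Y v ⟧ * ⟦ isZero (mult L v) ⟧
    low v  = ⟦ lookup Y v ⟧ * ⟦ not (atLeastTwo (mult L v)) ⟧

    exits : Fin (n G) → Fin (n G) → ℕ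
    exits u w = ∑ᴸ L (λ X → ⟦ lookup X u ∧ not (lookup X w) ⟧)

    -- Here `c` says whether the edge from `u` to `w` is covered. If `u` has multiplicity at least
    -- two, the left side vanishes. If it lies in one member only, that member is left at most once,
    -- and not at all when the edge is covered, since a covering member must be this one. If it lies
    -- in no member, the edge is uncovered and only `free u` remains.
    exits-bound : ∀ c u w → (c ≡ true → 1 ≤ ∑ᴸ L (λ X → ⟦ lookup X u ∧ lookup X w ⟧)) →
      exits u w * ⟦ not (atLeastTwo (mult L u)) ⟧ + free u ≤ ⟦ not c ⟧ * low u
    exits-bound c u w cov = bound c (lookup Y u) (exits u w) _ (mult L u) (split-mult L u w) cov in-Y
      where
      in-Y : 1 ≤ mult L u → lookup Y u ≡ true
      in-Y = mult-⊑ {Y = Y} L⊑Y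
      bound : ∀ c y a b k → a + b ≡ k → (c ≡ true → 1 ≤ b) → (1 ≤ k → y ≡ true) →
        a * ⟦ not (atLeastTwo k) ⟧ + ⟦ y ⟧ * ⟦ isZero k ⟧ ≤ ⟦ not c ⟧ * (⟦ y ⟧ * ⟦ not (atLeastTwo k) ⟧)
      bound c y a b (suc (suc k)) eq cov in-Y = ≤-trans (≤-reflexive (cong₂ _+_ (*-zeroʳ a) (*-zeroʳ ⟦ y ⟧))) z≤n
      bound true  y zero (suc zero) (suc zero) eq cov in-Y = ≤-reflexive (*-zeroʳ ⟦ y ⟧)
      bound c y (suc zero) zero (suc zero) eq cov in-Y with c | in-Y (s≤s z≤n)
      ... | true  | _    = absurd (n≮0 (cov refl))
      ... | false | refl = ≤-refl
      bound false y zero (suc zero) (suc zero) eq cov in-Y = ≤-trans (≤-reflexive (*-zeroʳ ⟦ y ⟧)) z≤n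
      bound true  y zero zero zero eq cov in-Y = absurd (n≮0 (cov refl))
      bound false y zero zero zero eq cov in-Y = m≤m+n _ 0

    -- An edge of G minus `common X` with one end in `own X` has its other end outside `X`. Each
    -- edge counted on the left is therefore charged to an end of multiplicity at most one, and
    -- `exits-bound` shows that no end is charged twice.
    boundary-bound : ∑ᴸ L (λ X → dMinus G (common X) (own X)) + ∑ (λ v → free v * degree G v) ≤
      ∑ (λ e → ⟦ not (covers L e) ⟧ * (low (end₁ G e) + low (end₂ G e)))
    boundary-bound = begin
      ∑ᴸ L (λ X → dMinus G (common X) (own X)) + ∑ (λ v → free v * degree G v)
        ≤⟨ +-mono-≤ (≤-reflexive (trans (∑ᴸ-cong L (λ X → count≡∑ _)) (∑ᴸ-∑-comm L _))) (∑-degree≤ free) ⟩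
      ∑ (λ e → ∑ᴸ L (λ X → leaves X e)) + ∑ (λ e → free (end₁ G e) + free (end₂ G e))
        ≡⟨ ∑-+ _ _ ⟨
      ∑ (λ e → ∑ᴸ L (λ X → leaves X e) + (free (end₁ G e) + free (end₂ G e)))
        ≤⟨ ∑-mono pointwise ⟩
      ∑ (λ e → ⟦ not (covers L e) ⟧ * (low (end₁ G e) + low (end₂ G e))) ∎
      where
      open ≤-Reasoning
      leaves : Subset (n G) → Fin (m G) → ℕ
      leaves X e = ⟦ not (in₁ G (common X) e) ∧ (not (in₂ G (common X) e) ∧ (in₁ G (own X) e xor in₂ G (own X) e)) ⟧

      bool : ∀ xu xw du dw → ⟦ not (xu ∧ du) ∧ (not (xw ∧ dw) ∧ ((xu ∧ not du) xor (xw ∧ not dw))) ⟧ ≤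
        ⟦ xu ∧ not xw ⟧ * ⟦ not du ⟧ + ⟦ xw ∧ not xu ⟧ * ⟦ not dw ⟧
      bool true  true  true  dw    = z≤n
      bool true  true  false true  = z≤n
      bool true  true  false false = z≤n
      bool true  false true  dw    = z≤n
      bool true  false false dw    = s≤s z≤n
      bool false true  du    true  = z≤n
      bool false true  du    false = s≤s z≤n
      bool false false du    dw    = z≤n

      leaves≤ : ∀ X e → leaves X e ≤
        ⟦ lookup X (end₁ G e) ∧ not (lookup X (end₂ G e)) ⟧ * ⟦ not (atLeastTwo (mult L (end₁ G e))) ⟧ +
        ⟦ lookup X (end₂ G e) ∧ not (lookup X (end₁ G e)) ⟧ * ⟦ not (atLeastTwo (mult L (end₂ G e))) ⟧
      leaves≤ X e rewrite lookup-∩ X shared (end₁ G e) | lookup-∩ X shared (end₂ G e)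
        | lookup-∩ X (∁ shared) (end₁ G e) | lookup-∩ X (∁ shared) (end₂ G e)
        | lookup-∁ shared (end₁ G e) | lookup-∁ shared (end₂ G e)
        | lookup-shared (end₁ G e) | lookup-shared (end₂ G e) =
        bool (lookup X (end₁ G e)) (lookup X (end₂ G e)) (atLeastTwo (mult L (end₁ G e))) (atLeastTwo (mult L (end₂ G e)))

      rearrange : ∀ a b c d → (a + b) + (c + d) ≡ (a + c) + (b + d)
      rearrange = solve-∀

      pointwise : ∀ e → ∑ᴸ L (λ X → leaves X e) + (free (end₁ G e) + free (end₂ G e)) ≤
        ⟦ not (covers L e) ⟧ * (low (end₁ G e) + low (end₂ G e))
      pointwise e = begin
        ∑ᴸ L (λ X → leaves X e) + (free u + free w)
          ≤⟨ +-monoˡ-≤ _ (∑ᴸ-mono (All.universal (λ X → leaves≤ X e) L)) ⟩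
        ∑ᴸ L (λ X → ⟦ lookup X u ∧ not (lookup X w) ⟧ * ⟦ not (atLeastTwo (mult L u)) ⟧ + ⟦ lookup X w ∧ not (lookup X u) ⟧ * ⟦ not (atLeastTwo (mult L w)) ⟧) + (free u + free w)
          ≡⟨ cong (_+ (free u + free w)) (trans (∑ᴸ-+ L _ _) (sym (cong₂ _+_ (∑ᴸ-*ʳ L _ _) (∑ᴸ-*ʳ L _ _)))) ⟩
        (exits u w * ⟦ not (atLeastTwo (mult L u)) ⟧ + exits w u * ⟦ not (atLeastTwo (mult L w)) ⟧) + (free u + free w)
          ≡⟨ rearrange (exits u w * ⟦ not (atLeastTwo (mult L u)) ⟧) _ (free u) (free w) ⟩
        (exits u w * ⟦ not (atLeastTwo (mult L u)) ⟧ + free u) + (exits w u * ⟦ not (atLeastTwo (mult L w)) ⟧ + free w)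
          ≤⟨ +-mono-≤ (exits-bound (covers L e) u w (covers⇒1≤∑ L e))
               (exits-bound (covers L e) w u λ p → ≤-trans (covers⇒1≤∑ L e p) (≤-reflexive (∑ᴸ-cong L λ X → cong ⟦_⟧ (∧-comm (lookup X u) (lookup X w))))) ⟩
        ⟦ not (covers L e) ⟧ * low u + ⟦ not (covers L e) ⟧ * low w
          ≡⟨ *-distribˡ-+ ⟦ not (covers L e) ⟧ (low u) (low w) ⟨
        ⟦ not (covers L e) ⟧ * (low u + low w) ∎
        where
        u = end₁ G e
        w = end₂ G e

-- Lower bounds from the degree and connectivity hypotheses

module Counting (G : Graph) (l ℓ : SetFun (n G))
  (l⊥ : ZeroOnEmpty l) (l-dec : Nonincreasing l) (ℓ⊥ : ZeroOnEmpty ℓ) (ℓ-sub : Subadditive ℓ)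
  (deg : ∀ v → 2 * pt ℓ v + 2 * pt l v ≤ degree G v)
  (conn : ∀ (A B : Subset (n G)) → A ∩ B ≡ ⊥ → A ∪ B ⊂ ⊤ →
    sumPt ℓ (A ∪ B) < eIn G ⊤ (A ∪ B) + ℓ (A ∪ B) →
    (A ≡ ⊥ → 2 * ℓ (A ∪ B) ≤ dMinus G B A + sumPt ℓ B) ×
    (Nonempty A → 2 * ℓ (A ∪ B) + 2 * l (A ∪ B) ≤ dMinus G B A + sumPt ℓ B)) where

  open Cover G
  open HalfEdges G
  open SubadditiveFunction ℓ ℓ⊥ ℓ-sub

  Dense : Subset (n G) → Set
  Dense X = sumPt ℓ X < eIn G ⊤ X + ℓ X

  module _ (Y : Subset (n G)) (L : List (Subset (n G))) (L⊑Y : All (_⊑ Y) L)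
    (dense : All Dense L) (proper : All (_≢ ⊤) L) where

    open Private Y L L⊑Y

    private
      -- What the connectivity hypothesis grants beyond `ℓ` for A = `own X` and B = `common X`: the
      -- term in `l` is available only for nonempty A.
      bonus : Subset (n G) → ℕ
      bonus X = if does (nonempty? (own X)) then l X else 0

      total : ℕ
      total = ∑ᴸ L bonus + ∑ (λ v → free v * pt l v)

      lowEdges : ℕ
      lowEdges = ∑ (λ e → ⟦ not (covers L e) ⟧ * (low (end₁ G e) + low (end₂ G e)))

      member-bound : ∀ X → Dense X × X ≢ ⊤ → 2 * ℓ X + 2 * bonus X ≤ dMinus G (common X) (own X) + sumPt ℓ (common X)
      member-bound X (dense-X , X≢⊤)
        with conn (own X) (common X) (own∩common X) (subst (_⊂ ⊤) (sym (own∪common X)) (≢⊤⇒⊂⊤ X X≢⊤)) (subst Dense (sym (own∪common X)) dense-X)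
           | nonempty? (own X)
      ... | _ , hyp | yes ne =
        subst (λ Z → 2 * ℓ Z + 2 * l Z ≤ dMinus G (common X) (own X) + sumPt ℓ (common X)) (own∪common X) (hyp ne)
      ... | hyp , _ | no e =
        subst (_≤ dMinus G (common X) (own X) + sumPt ℓ (common X)) (trans (cong (λ Z → 2 * ℓ Z) (own∪common X)) (sym (+-identityʳ _)))
          (hyp (empty⇒≡⊥ (own X) e))

      members-bound : 2 * ∑ᴸ L ℓ + 2 * ∑ᴸ L bonus ≤ ∑ᴸ L (λ X → dMinus G (common X) (own X)) + ∑ᴸ L (λ X → sumPt ℓ (common X))
      members-bound = subst₂ _≤_
        (trans (∑ᴸ-+ L _ _) (sym (cong₂ _+_ (∑ᴸ-*ˡ L 2 ℓ) (∑ᴸ-*ˡ L 2 bonus))))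
        (∑ᴸ-+ L _ _)
        (∑ᴸ-mono (All.map (λ {X} → member-bound X) (All.zip (dense , proper))))

      free-bound : 2 * ∑ (λ v → free v * pt ℓ v) + 2 * ∑ (λ v → free v * pt l v) ≤ ∑ (λ v → free v * degree G v)
      free-bound = begin
        2 * ∑ (λ v → free v * pt ℓ v) + 2 * ∑ (λ v → free v * pt l v)
          ≡⟨ cong₂ _+_ (∑-*ˡ 2 _) (∑-*ˡ 2 _) ⟩
        ∑ (λ v → 2 * (free v * pt ℓ v)) + ∑ (λ v → 2 * (free v * pt l v))
          ≡⟨ ∑-+ _ _ ⟨
        ∑ (λ v → 2 * (free v * pt ℓ v) + 2 * (free v * pt l v))
          ≤⟨ ∑-mono (λ v → ≤-trans (≤-reflexive (rearrange (free v) (pt ℓ v) (pt l v))) (*-monoʳ-≤ (free v) (deg v))) ⟩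
        ∑ (λ v → free v * degree G v) ∎
        where
        open ≤-Reasoning
        rearrange : ∀ f a b → 2 * (f * a) + 2 * (f * b) ≡ f * (2 * a + 2 * b)
        rearrange = solve-∀

      -- Compare the coefficients of `pt ℓ v` for a vertex of multiplicity k. For k at least 2 the
      -- left one is at most 2 + k, which is at most 2k; for k = 1 it is at most 2; for k = 0 the
      -- free term balances it exactly.
      vertex-bound : 2 * sumPt ℓ Y + ∑ᴸ L (λ X → sumPt ℓ (common X)) ≤ 2 * ∑ᴸ L (sumPt ℓ) + 2 * ∑ (λ v → free v * pt ℓ v)
      vertex-bound = begin
        2 * sumPt ℓ Y + ∑ᴸ L (λ X → sumPt ℓ (common X))
          ≡⟨ cong₂ _+_ (trans (cong (2 *_) (sumPt≡∑ ℓ Y)) (∑-*ˡ 2 _))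
               (trans (∑ᴸ-sumPt-∩ ℓ L shared) (∑-cong λ v → cong (λ b → mult L v * (⟦ b ⟧ * pt ℓ v)) (lookup-shared v))) ⟩
        ∑ (λ v → 2 * (⟦ lookup Y v ⟧ * pt ℓ v)) + ∑ (λ v → mult L v * (⟦ atLeastTwo (mult L v) ⟧ * pt ℓ v))
          ≡⟨ ∑-+ _ _ ⟨
        ∑ (λ v → 2 * (⟦ lookup Y v ⟧ * pt ℓ v) + mult L v * (⟦ atLeastTwo (mult L v) ⟧ * pt ℓ v))
          ≤⟨ ∑-mono (λ v → pointwise (lookup Y v) (mult L v) (pt ℓ v)) ⟩
        ∑ (λ v → 2 * (mult L v * pt ℓ v) + 2 * (free v * pt ℓ v))
          ≡⟨ ∑-+ _ _ ⟩
        ∑ (λ v → 2 * (mult L v * pt ℓ v)) + ∑ (λ v → 2 * (free v * pt ℓ v))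
          ≡⟨ cong₂ _+_ (trans (cong (2 *_) (∑ᴸ-sumPt ℓ L)) (∑-*ˡ 2 _)) (∑-*ˡ 2 _) ⟨
        2 * ∑ᴸ L (sumPt ℓ) + 2 * ∑ (λ v → free v * pt ℓ v) ∎
        where
        open ≤-Reasoning
        ⟦⟧*≤ : ∀ b x → ⟦ b ⟧ * x ≤ x
        ⟦⟧*≤ b x = ≤-trans (*-monoˡ-≤ x (⟦⟧≤1 b)) (≤-reflexive (*-identityˡ x))
        rearrange₀ : ∀ y x → 2 * (y * x) + 0 ≡ 2 * (0 * x) + 2 * (y * 1 * x)
        rearrange₀ = solve-∀
        rearrange₁ : ∀ x z → 2 * x + 1 * (0 * x) + z ≡ 2 * (1 * x) + z
        rearrange₁ = solve-∀
        rearrange₂ : ∀ k x → 2 * x + (2 + k) * (1 * x) + k * x ≡ 2 * ((2 + k) * x)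
        rearrange₂ = solve-∀
        pointwise : ∀ y k x → 2 * (⟦ y ⟧ * x) + k * (⟦ atLeastTwo k ⟧ * x) ≤ 2 * (k * x) + 2 * (⟦ y ⟧ * ⟦ isZero k ⟧ * x)
        pointwise y zero x = ≤-reflexive (rearrange₀ ⟦ y ⟧ x)
        pointwise y (suc zero) x = begin
          2 * (⟦ y ⟧ * x) + 1 * (0 * x)                            ≤⟨ +-monoˡ-≤ _ (*-monoʳ-≤ 2 (⟦⟧*≤ y x)) ⟩
          2 * x + 1 * (0 * x)                                      ≤⟨ m≤m+n _ _ ⟩
          2 * x + 1 * (0 * x) + 2 * (⟦ y ⟧ * 0 * x)                ≡⟨ rearrange₁ x _ ⟩
          2 * (1 * x) + 2 * (⟦ y ⟧ * 0 * x)                        ∎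
        pointwise y (suc (suc k)) x = begin
          2 * (⟦ y ⟧ * x) + (2 + k) * (1 * x)                      ≤⟨ +-monoˡ-≤ _ (*-monoʳ-≤ 2 (⟦⟧*≤ y x)) ⟩
          2 * x + (2 + k) * (1 * x)                                ≤⟨ m≤m+n _ _ ⟩
          2 * x + (2 + k) * (1 * x) + k * x                        ≡⟨ rearrange₂ k x ⟩
          2 * ((2 + k) * x)                                        ≤⟨ m≤m+n _ _ ⟩
          2 * ((2 + k) * x) + 2 * (⟦ y ⟧ * 0 * x)                  ∎

      -- The four preceding bounds are added up. The boundary sums, the degrees of free vertices and
      -- the vertex sums over `common X` cancel, and `∑ᴸ-defect+` turns the remaining vertex sums
      -- into defects.
      combined : 2 * sumPt ℓ Y + 2 * total ≤ 2 * ∑ᴸ L (defect ℓ) + lowEdges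
      combined = combine (sumPt ℓ Y) (∑ᴸ L ℓ) (∑ᴸ L bonus) _ _ (∑ (λ v → free v * pt ℓ v)) _ _ _ _
        members-bound free-bound vertex-bound boundary-bound (∑ᴸ-defect+ L)
        where
        eq₁ : ∀ s a b c t x y z →
          2 * s + 2 * (b + y) + (2 * a + 2 * x + t + c + z) ≡ (2 * a + 2 * b) + (2 * x + 2 * y) + (2 * s + t) + (c + z)
        eq₁ = solve-∀
        eq₂ : ∀ a c t x z d h →
          (c + t) + z + (2 * (d + a) + 2 * x) + h ≡ 2 * d + h + (2 * a + 2 * x + t + c + z)
        eq₂ = solve-∀
        combine : ∀ s a b c t x y z S h {d} → 2 * a + 2 * b ≤ c + t → 2 * x + 2 * y ≤ z → 2 * s + t ≤ 2 * S + 2 * x →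
          c + z ≤ h → d + a ≡ S → 2 * s + 2 * (b + y) ≤ 2 * d + h
        combine s a b c t x y z S h {d} p₁ p₂ p₃ p₄ refl =
          cancel-≤ (2 * a + 2 * x + t + c + z) (eq₁ s a b c t x y z) (+-mono-≤ (+-mono-≤ (+-mono-≤ p₁ p₂) p₃) p₄) (eq₂ a c t x z d h)

      -- One vertex of low multiplicity suffices. If it is free, its own value of `l` is at least
      -- `l Y`; if it lies in a single member `X`, then `own X` is nonempty and the bonus `l X` is
      -- at least `l Y`. Both use that `l` is nonincreasing.
      lY≤total : ∀ v → lookup Y v ≡ true → atLeastTwo (mult L v) ≡ false → l Y ≤ total
      lY≤total v v∈Y few with mult L v in eq
      ... | zero = ≤-trans (≤-trans lY≤ (term≤∑ (λ v → free v * pt l v) v)) (m≤n+m _ _)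
        where
        lY≤ : l Y ≤ free v * pt l v
        lY≤ rewrite v∈Y | eq = ≤-trans (l-dec ⁅ v ⁆ Y (v , x∈⁅x⁆ v) (⊑⇒⊆ {Y = Y} (⁅⁆⊑ {Y = Y} v∈Y))) (m≤m+n _ 0)
      ... | suc zero = ≤-trans (≤∑ᴸ-member v L⊑Y (≤-reflexive (sym eq)) lY≤) (m≤m+n _ _)
        where
        lY≤ : ∀ X → X ⊑ Y → lookup X v ≡ true → l Y ≤ bonus X
        lY≤ X X⊑Y v∈X with nonempty? (own X)
        ... | yes _ = l-dec X Y (v , lookup⇒[]= v X v∈X) (⊑⇒⊆ {Y = Y} X⊑Y)
        ... | no e  = absurd (e (v , lookup⇒[]= v (own X) (∩-intro X (∁ shared) v∈X
                        (trans (lookup-∁ shared v) (cong not (trans (lookup-shared v) (cong atLeastTwo eq)))))))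

    -- In the second case every vertex of Y lies in at least two members of L.
    dense-claim : (2 * sumPt ℓ Y + 2 * l Y ≤ 2 * ∑ᴸ L (defect ℓ) + halfEdges L Y) ⊎ (2 * sumPt ℓ Y ≤ 2 * ∑ᴸ L (defect ℓ))
    dense-claim with any? (λ v → (lookup Y v ∧ not (atLeastTwo (mult L v))) ≟ᵇ true)
    ... | yes (v , p) = inj₁ (begin
      2 * sumPt ℓ Y + 2 * l Y                ≤⟨ +-monoʳ-≤ (2 * sumPt ℓ Y) (*-monoʳ-≤ 2 (lY≤total v (proj₁ (∧-true p)) (not-true⇒false (proj₂ (∧-true {lookup Y v} p))))) ⟩
      2 * sumPt ℓ Y + 2 * total              ≤⟨ combined ⟩
      2 * ∑ᴸ L (defect ℓ) + lowEdges         ≤⟨ +-monoʳ-≤ (2 * ∑ᴸ L (defect ℓ)) (∑-mono λ e → *-monoʳ-≤ ⟦ not (covers L e) ⟧ (+-mono-≤ (low≤ (end₁ G e)) (low≤ (end₂ G e)))) ⟩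
      2 * ∑ᴸ L (defect ℓ) + halfEdges L Y    ∎)
      where
      open ≤-Reasoning
      low≤ : ∀ u → low u ≤ ⟦ lookup Y u ⟧
      low≤ u = ≤-trans (*-monoʳ-≤ ⟦ lookup Y u ⟧ (⟦⟧≤1 (not (atLeastTwo (mult L u))))) (≤-reflexive (*-identityʳ _))
    ... | no none = inj₂ (begin
      2 * sumPt ℓ Y                          ≤⟨ m≤m+n _ _ ⟩
      2 * sumPt ℓ Y + 2 * total              ≤⟨ combined ⟩
      2 * ∑ᴸ L (defect ℓ) + lowEdges         ≡⟨ cong (2 * ∑ᴸ L (defect ℓ) +_) (∑-zero λ e → trans (cong (⟦ not (covers L e) ⟧ *_) (cong₂ _+_ (low≡0 (end₁ G e)) (low≡0 (end₂ G e)))) (*-zeroʳ ⟦ not (covers L e) ⟧)) ⟩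
      2 * ∑ᴸ L (defect ℓ) + 0                ≡⟨ +-identityʳ _ ⟩
      2 * ∑ᴸ L (defect ℓ)                    ∎)
      where
      open ≤-Reasoning
      low≡0 : ∀ u → low u ≡ 0
      low≡0 u with lookup Y u in eqY | atLeastTwo (mult L u) in eqL
      ... | true  | true  = refl
      ... | false | _     = refl
      ... | true  | false = absurd (none (u , ∧-intro eqY (cong not eqL)))

  -- The clause for arbitrary `P` records that the members of `K` come from `L`, so that containment
  -- in `Y` and properness are inherited.
  prune : ∀ L → ∃₂ λ K S → All Dense K × (∀ {P : Subset (n G) → Set} → All P L → All P K) × All (λ X → ¬ Dense X) S ×
    (∀ e → covers L e ≡ true → covers K e ≡ true ⊎ covers S e ≡ true) ×
    ∑ᴸ K (defect ℓ) + ∑ᴸ S (defect ℓ) ≡ ∑ᴸ L (defect ℓ)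
  prune [] = [] , [] , [] , (λ p → p) , [] , (λ _ ()) , refl
  prune (X ∷ L) with prune L | sumPt ℓ X <? eIn G ⊤ X + ℓ X
  ... | K , S , dense , sub , sparse , cov , sum | yes p =
    X ∷ K , S , p ∷ dense , (λ { (q ∷ qs) → q ∷ sub qs }) , sparse , cov′ , trans (+-assoc (defect ℓ X) _ _) (cong (defect ℓ X +_) sum)
    where
    cov′ : ∀ e → covers (X ∷ L) e ≡ true → covers (X ∷ K) e ≡ true ⊎ covers S e ≡ true
    cov′ e q with inside X e | cov e
    ... | true  | _ = inj₁ refl
    ... | false | c = c q
  ... | K , S , dense , sub , sparse , cov , sum | no p =
    K , X ∷ S , dense , (λ { (q ∷ qs) → sub qs }) , p ∷ sparse , cov′ , trans (rearrange (∑ᴸ K (defect ℓ)) (defect ℓ X) _) (cong (defect ℓ X +_) sum)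
    where
    rearrange : ∀ a b c → a + (b + c) ≡ b + (a + c)
    rearrange = solve-∀
    cov′ : ∀ e → covers (X ∷ L) e ≡ true → covers K e ≡ true ⊎ covers (X ∷ S) e ≡ true
    cov′ e q with inside X e | cov e
    ... | true  | _ = inj₂ refl
    ... | false | c = c q

  eIn≡∑ : ∀ X → eIn G ⊤ X ≡ ∑ (λ e → ⟦ inside X e ⟧)
  eIn≡∑ X = trans (count≡∑ _) (∑-cong λ e → cong (λ b → ⟦ b ∧ inside X e ⟧) (lookup-⊤ e))

  -- Dropping a set that is not dense uncovers at most as many edges as its defect. Each of them
  -- brings at most two new half-edges, which the doubled defect of the dropped set pays for.
  claim : ∀ Y L → All (_⊑ Y) L → All (_≢ ⊤) L →
    (2 * sumPt ℓ Y + 2 * l Y ≤ 2 * ∑ᴸ L (defect ℓ) + halfEdges L Y) ⊎ (2 * sumPt ℓ Y ≤ 2 * ∑ᴸ L (defect ℓ))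
  claim Y L L⊑Y proper with prune L
  ... | K , S , dense , sub , sparse , cov , sum with dense-claim Y K (sub L⊑Y) dense (sub proper)
  ... | inj₂ p = inj₂ (≤-trans p (*-monoʳ-≤ 2 (≤-trans (m≤m+n (∑ᴸ K (defect ℓ)) _) (≤-reflexive sum))))
  ... | inj₁ p = inj₁ (begin
    2 * sumPt ℓ Y + 2 * l Y                          ≤⟨ p ⟩
    2 * ∑ᴸ K (defect ℓ) + halfEdges K Y              ≤⟨ +-monoʳ-≤ _ halfEdges-bound ⟩
    2 * ∑ᴸ K (defect ℓ) + (halfEdges L Y + 2 * ∑ᴸ S (defect ℓ)) ≡⟨ rearrange (∑ᴸ K (defect ℓ)) (∑ᴸ S (defect ℓ)) (halfEdges L Y) ⟩
    2 * (∑ᴸ K (defect ℓ) + ∑ᴸ S (defect ℓ)) + halfEdges L Y ≡⟨ cong (λ x → 2 * x + halfEdges L Y) sum ⟩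
    2 * ∑ᴸ L (defect ℓ) + halfEdges L Y              ∎)
    where
    open ≤-Reasoning
    rearrange : ∀ k s h → 2 * k + (h + 2 * s) ≡ 2 * (k + s) + h
    rearrange = solve-∀
    sparse-bound : ∀ {X} → ¬ Dense X → ∑ (λ e → ⟦ inside X e ⟧) ≤ defect ℓ X
    sparse-bound {X} p = +-cancelʳ-≤ (ℓ X) _ _ (subst₂ _≤_ (cong (_+ ℓ X) (eIn≡∑ X)) (sym (defect+ X)) (≮⇒≥ p))
    bool : ∀ cK cL (y : ℕ) s → y ≤ 2 → (cL ≡ true → cK ≡ true ⊎ 1 ≤ s) → ⟦ not cK ⟧ * y ≤ ⟦ not cL ⟧ * y + 2 * s
    bool true  cL    y s y≤2 p = z≤n
    bool false false y s y≤2 p = m≤m+n _ _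
    bool false true  y s y≤2 p with p refl
    ... | inj₂ q = ≤-trans (≤-reflexive (*-identityˡ y)) (≤-trans y≤2 (*-monoʳ-≤ 2 q))
    covered-by : ∀ e → covers L e ≡ true → covers K e ≡ true ⊎ 1 ≤ ∑ᴸ S (λ X → ⟦ inside X e ⟧)
    covered-by e q with cov e q
    ... | inj₁ r = inj₁ r
    ... | inj₂ r = inj₂ (covers⇒1≤∑ S e r)
    halfEdges-bound : halfEdges K Y ≤ halfEdges L Y + 2 * ∑ᴸ S (defect ℓ)
    halfEdges-bound = begin
      halfEdges K Y
        ≤⟨ ∑-mono (λ e → bool (covers K e) (covers L e) _ _ (+-mono-≤ (⟦⟧≤1 (lookup Y (end₁ G e))) (⟦⟧≤1 (lookup Y (end₂ G e)))) (covered-by e)) ⟩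
      ∑ (λ e → ⟦ not (covers L e) ⟧ * (⟦ lookup Y (end₁ G e) ⟧ + ⟦ lookup Y (end₂ G e) ⟧) + 2 * ∑ᴸ S (λ X → ⟦ inside X e ⟧))
        ≡⟨ trans (∑-+ _ _) (cong (halfEdges L Y +_) (trans (sym (∑-*ˡ 2 _)) (cong (2 *_) (sym (∑ᴸ-∑-comm S _))))) ⟩
      halfEdges L Y + 2 * ∑ᴸ S (λ X → ∑ (λ e → ⟦ inside X e ⟧))
        ≤⟨ +-monoʳ-≤ (halfEdges L Y) (*-monoʳ-≤ 2 (∑ᴸ-mono (All.map sparse-bound sparse))) ⟩
      halfEdges L Y + 2 * ∑ᴸ S (defect ℓ) ∎

  -- For dense `Y` this is the connectivity hypothesis with B empty. Otherwise the degree condition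
  -- is summed over `Y`: the degrees count the cut once and the inner edges twice, and the inner
  -- edges number at most `sumPt ℓ Y`, which cancels against the part of the degrees demanded for
  -- `ℓ`.
  cut-bound : ∀ Y → Nonempty Y → Y ≢ ⊤ → 2 * l Y ≤ ∑ (λ e → ⟦ in₁ G Y e xor in₂ G Y e ⟧)
  cut-bound Y ne Y≢⊤ with sumPt ℓ Y <? eIn G ⊤ Y + ℓ Y
  ... | yes dense = begin
    2 * l Y                                       ≤⟨ m≤n+m _ (2 * ℓ Y) ⟩
    2 * ℓ Y + 2 * l Y                             ≡⟨ cong (λ Z → 2 * ℓ Z + 2 * l Z) (∪-identityʳ Y) ⟨
    2 * ℓ (Y ∪ ⊥) + 2 * l (Y ∪ ⊥)                 ≤⟨ proj₂ (conn Y ⊥ (∩-zeroʳ Y) (subst (_⊂ ⊤) (sym (∪-identityʳ Y)) (≢⊤⇒⊂⊤ Y Y≢⊤)) (subst Dense (sym (∪-identityʳ Y)) dense)) ne ⟩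
    dMinus G ⊥ Y + sumPt ℓ ⊥                      ≡⟨ trans (cong (dMinus G ⊥ Y +_) (sumPt-⊥ ℓ)) (+-identityʳ _) ⟩
    dMinus G ⊥ Y                                  ≡⟨ trans (count≡∑ _) (∑-cong drop-⊥) ⟩
    ∑ (λ e → ⟦ in₁ G Y e xor in₂ G Y e ⟧)         ∎
    where
    open ≤-Reasoning
    drop-⊥ : ∀ e → ⟦ not (in₁ G ⊥ e) ∧ (not (in₂ G ⊥ e) ∧ (in₁ G Y e xor in₂ G Y e)) ⟧ ≡ ⟦ in₁ G Y e xor in₂ G Y e ⟧
    drop-⊥ e rewrite lookup-⊥ (end₁ G e) | lookup-⊥ (end₂ G e) = refl
  ... | no sparse = cancel-≤ (2 * sumPt ℓ Y) (+-comm (2 * l Y) (2 * sumPt ℓ Y)) (begin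
    2 * sumPt ℓ Y + 2 * l Y
      ≤⟨ +-monoʳ-≤ (2 * sumPt ℓ Y) (*-monoʳ-≤ 2 lY≤) ⟩
    2 * sumPt ℓ Y + 2 * sumPt l Y
      ≡⟨ cong₂ _+_ (trans (cong (2 *_) (sumPt≡∑ ℓ Y)) (∑-*ˡ 2 _)) (trans (cong (2 *_) (sumPt≡∑ l Y)) (∑-*ˡ 2 _)) ⟩
    ∑ (λ v → 2 * (⟦ lookup Y v ⟧ * pt ℓ v)) + ∑ (λ v → 2 * (⟦ lookup Y v ⟧ * pt l v))
      ≡⟨ ∑-+ _ _ ⟨
    ∑ (λ v → 2 * (⟦ lookup Y v ⟧ * pt ℓ v) + 2 * (⟦ lookup Y v ⟧ * pt l v))
      ≤⟨ ∑-mono (λ v → ≤-trans (≤-reflexive (rearrange ⟦ lookup Y v ⟧ (pt ℓ v) (pt l v))) (*-monoʳ-≤ ⟦ lookup Y v ⟧ (deg v))) ⟩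
    ∑ (λ v → ⟦ lookup Y v ⟧ * degree G v)
      ≤⟨ ∑-degree≤ (λ v → ⟦ lookup Y v ⟧) ⟩
    ∑ (λ e → ⟦ in₁ G Y e ⟧ + ⟦ in₂ G Y e ⟧)
      ≡⟨ trans (∑-cong λ e → bool (in₁ G Y e) (in₂ G Y e)) (trans (∑-+ _ _) (cong (∑ (λ e → ⟦ in₁ G Y e xor in₂ G Y e ⟧) +_) (trans (sym (∑-*ˡ 2 _)) (cong (2 *_) (sym (eIn≡∑ Y)))))) ⟩
    ∑ (λ e → ⟦ in₁ G Y e xor in₂ G Y e ⟧) + 2 * eIn G ⊤ Y
      ≤⟨ +-monoʳ-≤ (∑ (λ e → ⟦ in₁ G Y e xor in₂ G Y e ⟧)) (*-monoʳ-≤ 2 (≤-trans (m≤m+n _ (ℓ Y)) (≮⇒≥ sparse))) ⟩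
    ∑ (λ e → ⟦ in₁ G Y e xor in₂ G Y e ⟧) + 2 * sumPt ℓ Y ∎) refl
    where
    open ≤-Reasoning
    rearrange : ∀ f a b → 2 * (f * a) + 2 * (f * b) ≡ f * (2 * a + 2 * b)
    rearrange = solve-∀
    bool : ∀ a b → ⟦ a ⟧ + ⟦ b ⟧ ≡ ⟦ a xor b ⟧ + 2 * ⟦ a ∧ b ⟧
    bool true  true  = refl
    bool true  false = refl
    bool false true  = refl
    bool false false = refl
    lY≤ : l Y ≤ sumPt l Y
    lY≤ = SubadditiveFunction.≤sumPt l l⊥ (nonincreasing⇒subadditive l l-dec) Y

  -- When `claim` provides no term in `l`, the cut of `Y` does: all members of `L` lie in `Y`, so
  -- every edge leaving `Y` is uncovered and contributes a half-edge.
  proper-claim : ∀ Y L → All (_⊑ Y) L → Y ≢ ⊤ → 2 * sumPt ℓ Y + 2 * l Y ≤ 2 * ∑ᴸ L (defect ℓ) + halfEdges L Y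
  proper-claim Y L L⊑Y Y≢⊤ with nonempty? Y
  ... | no e rewrite empty⇒≡⊥ Y e | sumPt-⊥ ℓ | l⊥ = z≤n
  ... | yes ne with claim Y L L⊑Y (All.map proper L⊑Y)
    where
    proper : ∀ {X} → X ⊑ Y → X ≢ ⊤
    proper X⊑Y refl = Y≢⊤ (subset-ext λ v → trans (X⊑Y v (lookup-⊤ v)) (sym (lookup-⊤ v)))
  ... | inj₁ p = p
  ... | inj₂ p = +-mono-≤ p (≤-trans (cut-bound Y ne Y≢⊤) (∑-mono λ e → bool (covers L e) (in₁ G Y e) (in₂ G Y e) (ends-covered {Y} L e L⊑Y)))
    where
    bool : ∀ c a b → (c ≡ true → a ∧ b ≡ true) → ⟦ a xor b ⟧ ≤ ⟦ not c ⟧ * (⟦ a ⟧ + ⟦ b ⟧)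
    bool false true  true  p = z≤n
    bool false true  false p = ≤-refl
    bool false false true  p = ≤-refl
    bool false false false p = z≤n
    bool true  true  true  p = z≤n
    bool true  true  false p = absurd (true≢false (p refl) refl)
    bool true  false b     p = absurd (true≢false (p refl) refl)

-- Partition-connectivity of tight sparse edge sets

module PartitionConnectivity (G : Graph) where

  open Cover G

  -- The equality test inside fibre is a local function of Defs; it is recovered as the head of a
  -- fibre of a partition of an auxiliary edgeless graph.
  private
    edgeless : ℕ → Graph
    edgeless j = record { n = suc j ; m = 0 ; end₁ = λ () ; end₂ = λ () ; loopless = λ () }

    pointed : ∀ {j} → Fin j → Partition (edgeless j)
    pointed {j} a = record { k = j ; part = λ { zero → a ; (suc i) → i } ; surj = λ i → suc i , refl }

    eqTest : ∀ {j} → Fin j → Fin j → Bool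
    eqTest {j} a b = lookup (fibre (edgeless j) (pointed a) b) zero

    eqTest≡does : ∀ {j} (a b : Fin j) → eqTest a b ≡ does (a ≟ᶠ b)
    eqTest≡does zero    zero    = refl
    eqTest≡does zero    (suc b) = refl
    eqTest≡does (suc a) zero    = refl
    eqTest≡does (suc a) (suc b) = eqTest≡does a b

  lookup-fibre : ∀ (P : Partition G) i v → lookup (fibre G P i) v ≡ does (Partition.part P v ≟ᶠ i)
  lookup-fibre P i v = trans (lookup∘tabulate _ v) (eqTest≡does (Partition.part P v) i)

  -- Sparsity limits the number of edges inside each part, and tightness fixes the total number; the
  -- difference must cross between parts.
  tight⇒partitionConnected : ∀ (h : SetFun (n G)) F → (∀ X → eIn G F X + h X ≤ sumPt h X) → ∣ F ∣ + h ⊤ ≡ sumPt h ⊤ →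
    PartitionConnected G h F
  tight⇒partitionConnected h F sparse tight P = cancel-≤ (∑ inner) {a = ∑ inner + ∑ (λ i → h (fibre G P i))}
    (trans (cong (_+ ∑ inner) sumParts≡) (+-comm _ (∑ inner)))
    (begin
      ∑ inner + ∑ (λ i → h (fibre G P i))           ≡⟨ ∑-+ _ _ ⟨
      ∑ (λ i → inner i + h (fibre G P i))           ≤⟨ ∑-mono (λ i → sparse (fibre G P i)) ⟩
      ∑ (λ i → sumPt h (fibre G P i))               ≡⟨ ∑-sumPt ⟩
      sumPt h ⊤                                     ≡⟨ tight ⟨
      ∣ F ∣ + h ⊤                                   ≤⟨ +-monoˡ-≤ (h ⊤) card≤ ⟩
      eCross G F P + ∑ inner + h ⊤                  ∎)
    (rearrange (eCross G F P) (∑ inner) (h ⊤))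
    where
    open ≤-Reasoning
    open Partition P
    rearrange : ∀ a b c → a + b + c ≡ a + c + b
    rearrange = solve-∀
    inner : Fin k → ℕ
    inner i = eIn G F (fibre G P i)
    sumParts≡ : sumParts G h P ≡ ∑ (λ i → h (fibre G P i))
    sumParts≡ = trans (sumOver≡∑ {k} ⊤ _) (∑-cong λ i → trans (cong (λ b → ⟦ b ⟧ * h (fibre G P i)) (lookup-⊤ i)) (*-identityˡ _))
    one : ∀ v → ∑ (λ i → ⟦ lookup (fibre G P i) v ⟧) ≡ 1
    one v = trans (∑-cong λ i → trans (cong ⟦_⟧ (lookup-fibre P i v)) (sym (*-identityʳ _))) (∑-δ (part v) (const 1))
    ∑-sumPt : ∑ (λ i → sumPt h (fibre G P i)) ≡ sumPt h ⊤
    ∑-sumPt = begin-equality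
      ∑ (λ i → sumPt h (fibre G P i))                                  ≡⟨ ∑-cong (λ i → sumPt≡∑ h (fibre G P i)) ⟩
      ∑ (λ i → ∑ (λ v → ⟦ lookup (fibre G P i) v ⟧ * pt h v))           ≡⟨ ∑-comm _ ⟩
      ∑ (λ v → ∑ (λ i → ⟦ lookup (fibre G P i) v ⟧ * pt h v))           ≡⟨ ∑-cong (λ v → trans (sym (∑-*ʳ (pt h v) _)) (cong (_* pt h v) (trans (one v) (cong ⟦_⟧ (sym (lookup-⊤ v)))))) ⟩
      ∑ (λ v → ⟦ lookup ⊤ v ⟧ * pt h v)                                ≡⟨ sumPt≡∑ h ⊤ ⟨
      sumPt h ⊤                                                        ∎
    bool : ∀ f x y → y ≡ true → ⟦ f ⟧ ≤ ⟦ f ∧ not x ⟧ + ⟦ f ∧ (y ∧ x) ⟧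
    bool false x     y    p    = z≤n
    bool true  true  true refl = ≤-refl
    bool true  false true refl = ≤-refl
    crossing : Fin (m G) → Bool
    crossing e = lookup F e ∧ not (lookup (fibre G P (part (end₁ G e))) (end₂ G e))
    pointwise : ∀ e → ⟦ lookup F e ⟧ ≤ ⟦ crossing e ⟧ + ∑ (λ i → ⟦ lookup F e ∧ inside (fibre G P i) e ⟧)
    pointwise e = ≤-trans
      (bool (lookup F e) _ _ (trans (lookup-fibre P (part (end₁ G e)) (end₁ G e)) (dec-true (part (end₁ G e) ≟ᶠ part (end₁ G e)) refl)))
      (+-monoʳ-≤ ⟦ crossing e ⟧ (term≤∑ (λ i → ⟦ lookup F e ∧ inside (fibre G P i) e ⟧) (part (end₁ G e))))
    card≤ : ∣ F ∣ ≤ eCross G F P + ∑ inner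
    card≤ = begin
      ∣ F ∣                                                            ≡⟨ card≡∑ F ⟩
      ∑ (λ e → ⟦ lookup F e ⟧)                                         ≤⟨ ∑-mono pointwise ⟩
      ∑ (λ e → ⟦ crossing e ⟧ + ∑ (λ i → ⟦ lookup F e ∧ inside (fibre G P i) e ⟧)) ≡⟨ ∑-+ _ _ ⟩
      ∑ (λ e → ⟦ crossing e ⟧) + ∑ (λ e → ∑ (λ i → ⟦ lookup F e ∧ inside (fibre G P i) e ⟧)) ≡⟨ cong₂ _+_ (sym (count≡∑ crossing)) (trans (∑-comm _) (∑-cong λ i → sym (count≡∑ _))) ⟩
      eCross G F P + ∑ inner                                           ∎

-- Verification of the Hall condition and extraction of the packing

∑-one : ∀ k → ∑ {k} (const 1) ≡ k
∑-one zero    = ∑-zero λ ()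
∑-one (suc k) = trans (∑-suc _) (cong suc (∑-one k))

≡⊤? : ∀ {k} (X : Subset k) → Dec (X ≡ ⊤)
≡⊤? X = ≡-dec _≟ᵇ_ X ⊤

covers-map-∩ : ∀ G Y L e → Cover.covers G L e ≡ true → Cover.inside G Y e ≡ true → Cover.covers G (List.map (_∩ Y) L) e ≡ true
covers-map-∩ G Y (X ∷ L) e p q with ∨-true {Cover.inside G X e} p
... | inj₁ r = ∨-introˡ (Cover.inside-∩ G X Y e r q)
... | inj₂ r = ∨-introʳ {Cover.inside G (X ∩ Y) e} (covers-map-∩ G Y L e r q)

any⇒≤∑ᴸ : ∀ {k} {L : List (Subset k)} {X} (F : Subset k → ℕ) → Any (_≡ X) L → F X ≤ ∑ᴸ L F
any⇒≤∑ᴸ F (here refl) = m≤m+n _ _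
any⇒≤∑ᴸ F (there p)   = ≤-trans (any⇒≤∑ᴸ F p) (m≤n+m _ _)

module Packing (G : Graph) (l ℓ : SetFun (n G))
  (l⊥ : ZeroOnEmpty l) (l-dec : Nonincreasing l) (l-super : IntersectingSupermodular 1 l)
  (ℓ⊥ : ZeroOnEmpty ℓ) (ℓ-super : IntersectingSupermodular 2 ℓ) (ℓ-sub : Subadditive ℓ)
  (deg : ∀ v → 2 * pt ℓ v + 2 * pt l v ≤ degree G v)
  (conn : ∀ (A B : Subset (n G)) → A ∩ B ≡ ⊥ → A ∪ B ⊂ ⊤ →
    sumPt ℓ (A ∪ B) < eIn G ⊤ (A ∪ B) + ℓ (A ∪ B) →
    (A ≡ ⊥ → 2 * ℓ (A ∪ B) ≤ dMinus G B A + sumPt ℓ B) ×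
    (Nonempty A → 2 * ℓ (A ∪ B) + 2 * l (A ∪ B) ≤ dMinus G B A + sumPt ℓ B))
  (M : Subset (m G)) (M≤ : ∣ M ∣ ≤ l ⊤ + ℓ ⊤) where

  open Cover G
  open HalfEdges G
  open Counting G l ℓ l⊥ l-dec ℓ⊥ ℓ-sub deg conn
  module Sl = SubadditiveFunction l l⊥ (nonincreasing⇒subadditive l l-dec)
  module Sℓ = SubadditiveFunction ℓ ℓ⊥ ℓ-sub
  open Merging G (defect l) Sl.defect-⁅⁆ (Sl.defect-submodular l-super)

  target : ℕ
  target = defect l ⊤ + defect ℓ ⊤

  -- Edges of `M` are left out because their list contains only the waste colour. An edge that
  -- counts here cannot be covered in all colours of its initial list.
  uncovered : List (Subset (n G)) → List (Subset (n G)) → Fin (m G) → Bool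
  uncovered L₁ L₂ e = not (lookup M e) ∧ not (covers L₁ e ∧ covers L₂ e)

  halve : ∀ a b → 2 * a ≤ 2 * b → a ≤ b
  halve a b = *-cancelˡ-≤ 2

  ∑-M+uncovered : ∀ L₁ L₂ → ∑ (λ e → 2 * (⟦ lookup M e ⟧ + ⟦ uncovered L₁ L₂ e ⟧)) ≡ 2 * (∣ M ∣ + ∑ (λ e → ⟦ uncovered L₁ L₂ e ⟧))
  ∑-M+uncovered L₁ L₂ = trans (sym (∑-*ˡ 2 _)) (cong (2 *_) (trans (∑-+ _ _) (cong (_+ ∑ (λ e → ⟦ uncovered L₁ L₂ e ⟧)) (sym (card≡∑ M)))))

  -- The case in which the merged partition has V as a part. If V is also a member of `L₂`, its own
  -- cost suffices. Otherwise `claim` is applied to V: in its first alternative at most |M| + N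
  -- edges are uncovered by `L₂`, where N counts the `uncovered` edges, and the bound on |M| uses up
  -- `l ⊤` and reduces `sumPt ℓ ⊤` to the defect.
  whole-bound : ∀ L₁ L₂ → defect ℓ ⊤ ≤ ∑ (λ e → ⟦ uncovered L₁ L₂ e ⟧) + ∑ᴸ L₂ (defect ℓ)
  whole-bound L₁ L₂ with Any.any? ≡⊤? L₂
  ... | yes p = ≤-trans (any⇒≤∑ᴸ (defect ℓ) p) (m≤n+m _ _)
  ... | no p with claim ⊤ L₂ (All.universal (λ X v _ → lookup-⊤ v) L₂) (¬Any⇒All¬ L₂ p)
  ... | inj₂ q = ≤-trans (m∸n≤m (sumPt ℓ ⊤) (ℓ ⊤)) (≤-trans (halve (sumPt ℓ ⊤) (∑ᴸ L₂ (defect ℓ)) q) (m≤n+m _ _))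
  ... | inj₁ q = combine (defect ℓ ⊤) (ℓ ⊤) (l ⊤) (∑ᴸ L₂ (defect ℓ)) _ _ (Sℓ.defect+ ⊤) M≤ (≤-trans q (+-monoʳ-≤ (2 * ∑ᴸ L₂ (defect ℓ)) half))
    where
    bool : ∀ μ c₁ c₂ y → y ≤ 2 → ⟦ not c₂ ⟧ * y ≤ 2 * (⟦ μ ⟧ + ⟦ not μ ∧ not (c₁ ∧ c₂) ⟧)
    bool μ     c₁    true  y y≤2 = z≤n
    bool true  c₁    false y y≤2 = ≤-trans (≤-reflexive (*-identityˡ y)) y≤2
    bool false true  false y y≤2 = ≤-trans (≤-reflexive (*-identityˡ y)) y≤2
    bool false false false y y≤2 = ≤-trans (≤-reflexive (*-identityˡ y)) y≤2
    half : halfEdges L₂ ⊤ ≤ 2 * (∣ M ∣ + ∑ (λ e → ⟦ uncovered L₁ L₂ e ⟧))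
    half = ≤-trans
      (∑-mono λ e → bool (lookup M e) (covers L₁ e) (covers L₂ e) _ (+-mono-≤ (⟦⟧≤1 (lookup ⊤ (end₁ G e))) (⟦⟧≤1 (lookup ⊤ (end₂ G e)))))
      (≤-reflexive (∑-M+uncovered L₁ L₂))
    eq₁ : ∀ d a b → d + (a + b) ≡ d + a + b
    eq₁ = solve-∀
    eq₂ : ∀ a b D N → D + ((b + a) + N) ≡ N + D + (a + b)
    eq₂ = solve-∀
    eq₃ : ∀ s b → 2 * s + 2 * b ≡ 2 * (s + b)
    eq₃ = solve-∀
    combine : ∀ d a b D μ N {s} → d + a ≡ s → μ ≤ b + a → 2 * s + 2 * b ≤ 2 * D + 2 * (μ + N) → d ≤ N + D
    combine d a b D μ N refl μ≤ q = cancel-≤ (a + b) (eq₁ d a b)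
      (≤-trans (halve (d + a + b) (D + (μ + N)) (subst₂ _≤_ (eq₃ (d + a) b) (eq₃ D (μ + N)) q)) (+-monoʳ-≤ D (+-monoˡ-≤ N μ≤)))
      (eq₂ a b D N)

  -- `proper-claim` is summed over the parts, each with `L₂` cut down to it; by `∑-defect-∩` the
  -- cutting does not raise the total defect.
  parts-bound : ∀ L₁ L₂ P → (∀ v → mult P v ≡ 1) → (∀ e → covers L₁ e ≡ true → covers P e ≡ true) → All (_≢ ⊤) P →
    sumPt ℓ ⊤ + ∑ᴸ P l ≤ ∑ᴸ L₂ (defect ℓ) + (∣ M ∣ + ∑ (λ e → ⟦ uncovered L₁ L₂ e ⟧))
  parts-bound L₁ L₂ P mult-P cov proper = halve _ _ (begin
    2 * (sumPt ℓ ⊤ + ∑ᴸ P l)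
      ≡⟨ *-distribˡ-+ 2 (sumPt ℓ ⊤) (∑ᴸ P l) ⟩
    2 * sumPt ℓ ⊤ + 2 * ∑ᴸ P l
      ≡⟨ cong (λ x → 2 * x + 2 * ∑ᴸ P l) ∑-sumPt ⟨
    2 * ∑ᴸ P (sumPt ℓ) + 2 * ∑ᴸ P l
      ≡⟨ trans (cong₂ _+_ (∑ᴸ-*ˡ P 2 (sumPt ℓ)) (∑ᴸ-*ˡ P 2 l)) (sym (∑ᴸ-+ P _ _)) ⟩
    ∑ᴸ P (λ Y → 2 * sumPt ℓ Y + 2 * l Y)
      ≤⟨ ∑ᴸ-mono (All.map (λ {Y} → proper-claim Y (restrict Y) (restrict⊑ Y L₂)) proper) ⟩
    ∑ᴸ P (λ Y → 2 * ∑ᴸ (restrict Y) (defect ℓ) + halfEdges (restrict Y) Y)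
      ≡⟨ ∑ᴸ-+ P _ _ ⟩
    ∑ᴸ P (λ Y → 2 * ∑ᴸ (restrict Y) (defect ℓ)) + ∑ᴸ P (λ Y → halfEdges (restrict Y) Y)
      ≤⟨ +-mono-≤ defects (≤-trans (≤-reflexive (∑ᴸ-∑-comm P _)) (≤-trans (∑-mono pointwise) (≤-reflexive (∑-M+uncovered L₁ L₂)))) ⟩
    2 * ∑ᴸ L₂ (defect ℓ) + 2 * (∣ M ∣ + ∑ (λ e → ⟦ uncovered L₁ L₂ e ⟧))
      ≡⟨ *-distribˡ-+ 2 (∑ᴸ L₂ (defect ℓ)) _ ⟨
    2 * (∑ᴸ L₂ (defect ℓ) + (∣ M ∣ + ∑ (λ e → ⟦ uncovered L₁ L₂ e ⟧))) ∎)
    where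
    open ≤-Reasoning
    restrict : Subset (n G) → List (Subset (n G))
    restrict Y = List.map (_∩ Y) L₂
    restrict⊑ : ∀ Y L → All (_⊑ Y) (List.map (_∩ Y) L)
    restrict⊑ Y []      = []
    restrict⊑ Y (X ∷ L) = (λ v p → proj₂ (∩-elim X Y p)) ∷ restrict⊑ Y L
    ∑-sumPt : ∑ᴸ P (sumPt ℓ) ≡ sumPt ℓ ⊤
    ∑-sumPt = trans (∑ᴸ-sumPt ℓ P) (trans (∑-cong λ v → cong (_* pt ℓ v) (trans (mult-P v) (cong ⟦_⟧ (sym (lookup-⊤ v))))) (sym (sumPt≡∑ ℓ ⊤)))
    defects : ∑ᴸ P (λ Y → 2 * ∑ᴸ (restrict Y) (defect ℓ)) ≤ 2 * ∑ᴸ L₂ (defect ℓ)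
    defects = begin
      ∑ᴸ P (λ Y → 2 * ∑ᴸ (restrict Y) (defect ℓ))       ≡⟨ ∑ᴸ-*ˡ P 2 _ ⟨
      2 * ∑ᴸ P (λ Y → ∑ᴸ (restrict Y) (defect ℓ))       ≡⟨ cong (2 *_) (trans (∑ᴸ-cong P λ Y → ∑ᴸ-map (_∩ Y) L₂ (defect ℓ)) (∑ᴸ-comm P L₂ _)) ⟩
      2 * ∑ᴸ L₂ (λ X → ∑ᴸ P (λ Y → defect ℓ (X ∩ Y)))   ≤⟨ *-monoʳ-≤ 2 (∑ᴸ-mono (All.universal (λ X → Sℓ.∑-defect-∩ P X mult-P) L₂)) ⟩
      2 * ∑ᴸ L₂ (defect ℓ)                              ∎
    -- The two ends of `e` lie in one part each, so it counts at most twice. If both lists cover it,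
    -- both ends lie in the same part, where the restricted list still covers it, and it does not
    -- count at all.
    pointwise : ∀ e → ∑ᴸ P (λ Y → ⟦ not (covers (restrict Y) e) ⟧ * (⟦ in₁ G Y e ⟧ + ⟦ in₂ G Y e ⟧)) ≤
      2 * (⟦ lookup M e ⟧ + ⟦ uncovered L₁ L₂ e ⟧)
    pointwise e = cases (lookup M e) (covers L₁ e ∧ covers L₂ e) (λ p → none (∧-true {covers L₁ e} p))
      where
      u = end₁ G e
      w = end₂ G e
      lhs = ∑ᴸ P (λ Y → ⟦ not (covers (restrict Y) e) ⟧ * (⟦ lookup Y u ⟧ + ⟦ lookup Y w ⟧))
      ≤two : lhs ≤ 2
      ≤two = begin
        lhs                                              ≤⟨ ∑ᴸ-mono (All.universal (λ Y → ≤-trans (*-monoˡ-≤ _ (⟦⟧≤1 (not (covers (restrict Y) e)))) (≤-reflexive (*-identityˡ _))) P) ⟩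
        ∑ᴸ P (λ Y → ⟦ lookup Y u ⟧ + ⟦ lookup Y w ⟧)      ≡⟨ trans (∑ᴸ-+ P _ _) (cong₂ _+_ (mult-P u) (mult-P w)) ⟩
        2                                                ∎
      cases : ∀ μ c → (c ≡ true → lhs ≤ 0) → lhs ≤ 2 * (⟦ μ ⟧ + ⟦ not μ ∧ not c ⟧)
      cases true  c     p = ≤two
      cases false true  p = p refl
      cases false false p = ≤two
      bool : ∀ c a b → (a ∧ b ≡ true → c ≡ true) → ⟦ not c ⟧ * (⟦ a ⟧ + ⟦ b ⟧) ≤ ⟦ a ∧ not b ⟧ + ⟦ b ∧ not a ⟧
      bool true  a     b     p = z≤n
      bool false true  true  p = absurd (true≢false (p refl) refl)
      bool false true  false p = ≤-refl
      bool false false true  p = ≤-refl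
      bool false false false p = z≤n
      no-exit : ∀ u w → 1 ≤ ∑ᴸ P (λ Y → ⟦ lookup Y u ∧ lookup Y w ⟧) → ∑ᴸ P (λ Y → ⟦ lookup Y u ∧ not (lookup Y w) ⟧) ≤ 0
      no-exit u w p = +-cancelʳ-≤ 1 _ 0 (≤-trans (+-monoʳ-≤ _ p) (≤-reflexive (trans (split-mult P u w) (mult-P u))))
      none : covers L₁ e ≡ true × covers L₂ e ≡ true → lhs ≤ 0
      none (c₁ , c₂) = begin
        lhs
          ≤⟨ ∑ᴸ-mono (All.universal (λ Y → bool (covers (restrict Y) e) (lookup Y u) (lookup Y w) (covers-map-∩ G Y L₂ e c₂)) P) ⟩
        ∑ᴸ P (λ Y → ⟦ lookup Y u ∧ not (lookup Y w) ⟧ + ⟦ lookup Y w ∧ not (lookup Y u) ⟧)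
          ≡⟨ ∑ᴸ-+ P _ _ ⟩
        ∑ᴸ P (λ Y → ⟦ lookup Y u ∧ not (lookup Y w) ⟧) + ∑ᴸ P (λ Y → ⟦ lookup Y w ∧ not (lookup Y u) ⟧)
          ≤⟨ +-mono-≤ (no-exit u w both) (no-exit w u (≤-trans both (≤-reflexive (∑ᴸ-cong P λ Y → cong ⟦_⟧ (∧-comm (lookup Y u) (lookup Y w)))))) ⟩
        0 ∎
        where
        both : 1 ≤ ∑ᴸ P (λ Y → ⟦ lookup Y u ∧ lookup Y w ⟧)
        both = covers⇒1≤∑ P e (cov e c₁)

  -- After merging `L₁` into a partition, a part equal to V pays for `defect l ⊤` alone and
  -- `whole-bound` does the rest. Without such a part, `parts-bound` supplies the sum of `l` over
  -- the parts, which together with their defects is all of `sumPt l ⊤`; the bound on |M| accounts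
  -- for `l ⊤` and `ℓ ⊤`.
  target-bound : ∀ L₁ L₂ → target ≤ ∑ (λ e → ⟦ uncovered L₁ L₂ e ⟧) + (∑ᴸ L₁ (defect l) + ∑ᴸ L₂ (defect ℓ))
  target-bound L₁ L₂ with mergeAll L₁
  ... | P , mult-P , cov , cost with Any.any? ≡⊤? P
  ... | yes p = ≤-trans (+-mono-≤ (≤-trans (any⇒≤∑ᴸ (defect l) p) cost) (whole-bound L₁ L₂)) (≤-reflexive (rearrange (∑ᴸ L₁ (defect l)) (∑ (λ e → ⟦ uncovered L₁ L₂ e ⟧)) (∑ᴸ L₂ (defect ℓ))))
    where
    rearrange : ∀ a b c → a + (b + c) ≡ b + (a + c)
    rearrange = solve-∀
  ... | no p = combine (defect l ⊤) (l ⊤) (defect ℓ ⊤) (ℓ ⊤) (∑ᴸ P (defect l)) (∑ᴸ P l) _ (∑ᴸ L₁ (defect l)) (∑ᴸ L₂ (defect ℓ)) _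
    (trans (Sl.∑ᴸ-defect+ P) (trans ∑-sumPt (sym (Sl.defect+ ⊤)))) cost M≤
    (subst (λ x → x + ∑ᴸ P l ≤ ∑ᴸ L₂ (defect ℓ) + (∣ M ∣ + ∑ (λ e → ⟦ uncovered L₁ L₂ e ⟧))) (sym (Sℓ.defect+ ⊤))
      (parts-bound L₁ L₂ P mult-P cov (¬Any⇒All¬ P p)))
    where
    ∑-sumPt : ∑ᴸ P (sumPt l) ≡ sumPt l ⊤
    ∑-sumPt = trans (∑ᴸ-sumPt l P) (trans (∑-cong λ v → cong (_* pt l v) (trans (mult-P v) (cong ⟦_⟧ (sym (lookup-⊤ v))))) (sym (sumPt≡∑ l ⊤)))
    eq₁ : ∀ g a f b p → g + f + (a + b + p) ≡ (g + a) + (f + b + p)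
    eq₁ = solve-∀
    eq₂ : ∀ a b p C D N → (C + p) + (D + ((a + b) + N)) ≡ N + (C + D) + (a + b + p)
    eq₂ = solve-∀
    combine : ∀ g a f b c p μ C D N → c + p ≡ g + a → c ≤ C → μ ≤ a + b → f + b + p ≤ D + (μ + N) → g + f ≤ N + (C + D)
    combine g a f b c p μ C D N e₁ c≤C μ≤ q = cancel-≤ (a + b + p) (eq₁ g a f b p)
      (+-mono-≤ (subst (_≤ C + p) e₁ (+-monoˡ-≤ p c≤C)) (≤-trans q (+-monoʳ-≤ D (+-monoˡ-≤ N μ≤)))) (eq₂ a b p C D N)
  -- The third colour absorbs M and the m - target superfluous edges.
  colours : Fin 3 → SetFun (n G)
  colours 0F = defect l
  colours 1F = defect ℓ
  colours 2F = const (m G ∸ target)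

  colours-submodular : ∀ i → Submodular₂ (colours i)
  colours-submodular 0F A B 2≤ = Sl.defect-submodular l-super A B (≤-trans (s≤s z≤n) 2≤)
  colours-submodular 1F = Sℓ.defect-submodular ℓ-super
  colours-submodular 2F A B 2≤ = ≤-refl

  open Colouring G colours colours-submodular

  families : List (Subset (n G)) → List (Subset (n G)) → List (Subset (n G)) → Families
  families L₁ L₂ L₃ 0F = L₁
  families L₁ L₂ L₃ 1F = L₂
  families L₁ L₂ L₃ 2F = L₃

  ∑-three : ∀ (f : Fin 3 → ℕ) → ∑ f ≡ f 0F + (f 1F + f 2F)
  ∑-three f = trans (∑-suc f) (cong (f 0F +_) (trans (∑-suc _) (cong (f 1F +_)
    (trans (∑-suc _) (trans (cong (f 2F +_) (∑-zero λ ())) (+-identityʳ _))))))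

  initial : Choices
  initial e = if lookup M e then (2F , []) else (0F , 1F ∷ 2F ∷ [])

  -- Every list contains the waste colour, so an empty third family covers nothing. A nonempty one
  -- costs at least `m G ∸ target`. As no edge is both covered and `uncovered`, the claim then
  -- reduces to `target-bound`.
  initial-feasible : Feasible initial
  initial-feasible 𝓕 with 𝓕 2F in eq
  ... | [] = ≤-trans (≤-reflexive (∑-zero none)) z≤n
    where
    none : ∀ e → ⟦ covered initial 𝓕 e ⟧ ≡ 0
    none e with lookup M e
    ... | true  rewrite eq = refl
    ... | false rewrite eq = cong ⟦_⟧ (trans (cong (covers (𝓕 0F) e ∧_) (∧-zeroʳ (covers (𝓕 1F) e))) (∧-zeroʳ (covers (𝓕 0F) e)))
  ... | X ∷ L = cancel-≤ N {a = ∑ (λ e → ⟦ covered initial 𝓕 e ⟧) + N} refl (begin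
    ∑ (λ e → ⟦ covered initial 𝓕 e ⟧) + N               ≡⟨ ∑-+ _ _ ⟨
    ∑ (λ e → ⟦ covered initial 𝓕 e ⟧ + ⟦ uncovered (𝓕 0F) (𝓕 1F) e ⟧) ≤⟨ ∑-mono pointwise ⟩
    ∑ (const 1)                                         ≡⟨ ∑-one (m G) ⟩
    m G                                                 ≤⟨ m≤n+m∸n (m G) target ⟩
    target + (m G ∸ target)                             ≤⟨ +-mono-≤ (target-bound (𝓕 0F) (𝓕 1F)) third ⟩
    (N + (c₁ + c₂)) + c₃                                ≡⟨ rearrange N c₁ c₂ c₃ ⟩
    (c₁ + (c₂ + c₃)) + N                                ≡⟨ cong (_+ N) (∑-three _) ⟨
    cost 𝓕 + N                                          ∎) refl
    where
    open ≤-Reasoning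
    N c₁ c₂ c₃ : ℕ
    N  = ∑ (λ e → ⟦ uncovered (𝓕 0F) (𝓕 1F) e ⟧)
    c₁ = ∑ᴸ (𝓕 0F) (defect l)
    c₂ = ∑ᴸ (𝓕 1F) (defect ℓ)
    c₃ = ∑ᴸ (𝓕 2F) (const (m G ∸ target))
    third : m G ∸ target ≤ c₃
    third rewrite eq = m≤m+n _ _
    rearrange : ∀ N a b c → (N + (a + b)) + c ≡ (a + (b + c)) + N
    rearrange = solve-∀
    bool : ∀ a b c → ⟦ a ∧ (b ∧ (c ∧ true)) ⟧ + ⟦ not (a ∧ b) ⟧ ≤ 1
    bool true  true  c = ≤-trans (≤-reflexive (+-identityʳ _)) (⟦⟧≤1 (c ∧ true))
    bool true  false c = ≤-refl
    bool false b     c = ≤-refl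
    pointwise : ∀ e → ⟦ covered initial 𝓕 e ⟧ + ⟦ uncovered (𝓕 0F) (𝓕 1F) e ⟧ ≤ 1
    pointwise e with lookup M e
    ... | true  = ≤-trans (≤-reflexive (+-identityʳ _)) (⟦⟧≤1 (covers (𝓕 2F) e ∧ true))
    ... | false = bool (covers (𝓕 0F) e) (covers (𝓕 1F) e) (covers (𝓕 2F) e)

  target≤m : target ≤ m G
  target≤m = begin
    target                                         ≤⟨ target-bound [] [] ⟩
    ∑ (λ e → ⟦ uncovered [] [] e ⟧) + 0            ≡⟨ +-identityʳ _ ⟩
    ∑ (λ e → ⟦ uncovered [] [] e ⟧)                ≤⟨ ∑-mono (λ e → ⟦⟧≤1 (uncovered [] [] e)) ⟩
    ∑ (const 1)                                    ≡⟨ ∑-one (m G) ⟩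
    m G                                            ∎
    where open ≤-Reasoning

  -- Sparsity and tightness are kept in this form because they are decidable by search over finitely
  -- many subsets, which is what removes the double negation of `colour`.
  Packed : Subset (m G) → Subset (m G) → Set
  Packed F₁ F₂ =
    ((∀ X → eIn G F₁ X + l X ≤ sumPt l X) × (∣ F₁ ∣ + l ⊤ ≡ sumPt l ⊤)) ×
    ((∀ X → eIn G F₂ X + ℓ X ≤ sumPt ℓ X) × (∣ F₂ ∣ + ℓ ⊤ ≡ sumPt ℓ ⊤)) ×
    (M ∩ F₁ ≡ ⊥) × (M ∩ F₂ ≡ ⊥) × (F₁ ∩ F₂ ≡ ⊥)

  packed? : ∀ F₁ F₂ → Dec (Packed F₁ F₂)
  packed? F₁ F₂ = (allSubset? (λ X → _ ≤? _) ×-dec (_ ≟ _)) ×-dec (allSubset? (λ X → _ ≤? _) ×-dec (_ ≟ _)) ×-dec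
    ≡-dec _≟ᵇ_ _ _ ×-dec ≡-dec _≟ᵇ_ _ _ ×-dec ≡-dec _≟ᵇ_ _ _
    where
    allSubset? : ∀ {k} {P : Subset k → Set} → (∀ X → Dec (P X)) → Dec (∀ X → P X)
    allSubset? P? with anySubset? (λ X → ¬? (P? X))
    ... | yes (X , ¬p) = no λ all → ¬p (all X)
    ... | no none = yes λ X → decidable-stable (P? X) λ ¬p → none (X , ¬p)

  module _ (c : Fin (m G) → Fin 3) (feasible : Feasible (λ e → c e , [])) where

    class : Fin 3 → Subset (m G)
    class i = Vec.tabulate (λ e → does (c e ≟ᶠ i))

    lookup-class : ∀ i e → lookup (class i) e ≡ does (c e ≟ᶠ i)
    lookup-class i e = lookup∘tabulate _ e

    class⇒≡ : ∀ {i e} → lookup (class i) e ≡ true → c e ≡ i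
    class⇒≡ {i} {e} p with c e ≟ᶠ i | trans (sym (lookup-class i e)) p
    ... | yes q | _ = q

    -- Every edge of colour `i` inside `X` is covered by `𝓕`, so feasibility bounds their number by
    -- the cost. Below, `𝓕` has `X` as its only set, in colour `i`.
    class-bound : ∀ i 𝓕 X → covers (𝓕 i) ≡ (λ e → inside X e ∨ false) → eIn G (class i) X ≤ cost 𝓕
    class-bound i 𝓕 X eq = ≤-trans (≤-reflexive (count≡∑ _)) (≤-trans (∑-mono λ e → ⟦⟧-mono (pointwise e)) (feasible 𝓕))
      where
      pointwise : ∀ e → lookup (class i) e ∧ inside X e ≡ true → covered (λ e → c e , []) 𝓕 e ≡ true
      pointwise e p with ∧-true {lookup (class i) e} p
      ... | q , r = ∧-intro (trans (cong (λ j → covers (𝓕 j) e) (class⇒≡ q)) (trans (cong (λ h → h e) eq) (∨-introˡ r))) refl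

    card≤eIn : ∀ F → ∣ F ∣ ≤ eIn G F ⊤
    card≤eIn F = ≤-trans (≤-reflexive (card≡∑ F)) (≤-trans
      (∑-mono λ e → ⟦⟧-mono λ p → ∧-intro p (∧-intro (lookup-⊤ (end₁ G e)) (lookup-⊤ (end₂ G e)))) (≤-reflexive (sym (count≡∑ _))))

    bound₁ : ∀ X → eIn G (class 0F) X ≤ defect l X
    bound₁ X = ≤-trans (class-bound 0F (families (X ∷ []) [] []) X refl) (≤-reflexive (trans (∑-three _) (trans (+-identityʳ _) (+-identityʳ _))))

    bound₂ : ∀ X → eIn G (class 1F) X ≤ defect ℓ X
    bound₂ X = ≤-trans (class-bound 1F (families [] (X ∷ []) []) X refl) (≤-reflexive (trans (∑-three _) (trans (+-identityʳ _) (+-identityʳ _))))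

    bound₃ : ∣ class 2F ∣ ≤ m G ∸ target
    bound₃ = ≤-trans (card≤eIn (class 2F)) (≤-trans (class-bound 2F (families [] [] (⊤ ∷ [])) ⊤ refl) (≤-reflexive (trans (∑-three _) (+-identityʳ _))))

    cards : ∣ class 0F ∣ + (∣ class 1F ∣ + ∣ class 2F ∣) ≡ m G
    cards = begin
      ∣ class 0F ∣ + (∣ class 1F ∣ + ∣ class 2F ∣)  ≡⟨ ∑-three (λ i → ∣ class i ∣) ⟨
      ∑ (λ i → ∣ class i ∣)                            ≡⟨ ∑-cong (λ i → trans (card≡∑ (class i)) (∑-cong λ e → cong ⟦_⟧ (lookup-class i e))) ⟩
      ∑ (λ i → ∑ (λ e → ⟦ does (c e ≟ᶠ i) ⟧))          ≡⟨ ∑-comm _ ⟩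
      ∑ (λ e → ∑ (λ i → ⟦ does (c e ≟ᶠ i) ⟧))          ≡⟨ ∑-cong (λ e → trans (∑-cong λ i → sym (*-identityʳ _)) (∑-δ (c e) (const 1))) ⟩
      ∑ (const 1)                                      ≡⟨ ∑-one (m G) ⟩
      m G                                              ∎
      where open ≡-Reasoning

    -- The three classes exhaust the edges and their upper bounds add up to exactly `m G`, so none
    -- of the bounds can be strict.
    tight : ∣ class 0F ∣ ≡ defect l ⊤ × ∣ class 1F ∣ ≡ defect ℓ ⊤
    tight = squeeze _ _ _ _ _ (≤-trans (card≤eIn (class 0F)) (bound₁ ⊤)) (≤-trans (card≤eIn (class 1F)) (bound₂ ⊤)) (begin
      target + (m G ∸ target)                                ≡⟨ m+[n∸m]≡n target≤m ⟩
      m G                                                    ≡⟨ cards ⟨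
      ∣ class 0F ∣ + (∣ class 1F ∣ + ∣ class 2F ∣)  ≡⟨ +-assoc ∣ class 0F ∣ _ _ ⟨
      ∣ class 0F ∣ + ∣ class 1F ∣ + ∣ class 2F ∣    ≤⟨ +-monoʳ-≤ (∣ class 0F ∣ + ∣ class 1F ∣) bound₃ ⟩
      ∣ class 0F ∣ + ∣ class 1F ∣ + (m G ∸ target) ∎)
      where
      open ≤-Reasoning
      squeeze : ∀ a b x y k → a ≤ x → b ≤ y → x + y + k ≤ a + b + k → a ≡ x × b ≡ y
      squeeze a b x y k a≤x b≤y p =
        ≤-antisym a≤x (+-cancelʳ-≤ b x a (≤-trans (+-monoʳ-≤ x b≤y) q)) ,
        ≤-antisym b≤y (+-cancelˡ-≤ a y b (≤-trans (+-monoˡ-≤ y a≤x) q))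
        where
        q : x + y ≤ a + b
        q = +-cancelʳ-≤ k (x + y) (a + b) p

    packed : (∀ e → lookup M e ≡ true → c e ≡ 2F) → Packed (class 0F) (class 1F)
    packed M-third =
      ((λ X → ≤-trans (+-monoˡ-≤ (l X) (bound₁ X)) (≤-reflexive (Sl.defect+ X))) , trans (cong (_+ l ⊤) (proj₁ tight)) (Sl.defect+ ⊤)) ,
      ((λ X → ≤-trans (+-monoˡ-≤ (ℓ X) (bound₂ X)) (≤-reflexive (Sℓ.defect+ X))) , trans (cong (_+ ℓ ⊤) (proj₂ tight)) (Sℓ.defect+ ⊤)) ,
      avoids-M 0F (λ ()) , avoids-M 1F (λ ()) ,
      empty-ext λ e p → let (p₀ , p₁) = ∩-elim (class 0F) (class 1F) p in
        distinct (trans (sym (class⇒≡ p₀)) (class⇒≡ p₁))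
      where
      distinct : 0F ≡ 1F → Empty
      distinct ()
      avoids-M : ∀ i → 2F ≢ i → M ∩ class i ≡ ⊥
      avoids-M i ≢i = empty-ext λ e p → let (pM , pi) = ∩-elim M (class i) p in ≢i (trans (sym (M-third e pM)) (class⇒≡ pi))

  packing : ∃₂ Packed
  -- A pair of edge sets can be searched for, so it is enough to refute its absence.
  packing = decidable-stable (anySubset? λ F₁ → anySubset? (packed? F₁)) λ ¬packing →
    colour (λ e i → lookup M e ≡ true → i ≡ 2F) initial allowed initial-feasible
      λ { (c , M-third , feasible) → ¬packing (class c feasible 0F , class c feasible 1F , packed c feasible M-third) }
    where
    allowed : ∀ e → All (λ i → lookup M e ≡ true → i ≡ 2F) (proj₁ (initial e) ∷ proj₂ (initial e))
    allowed e with lookup M e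
    ... | true  = (λ _ → refl) ∷ []
    ... | false = (λ ()) ∷ (λ ()) ∷ (λ ()) ∷ []

-- The decomposition of the edge set

theorem6p1 : (G : Graph) (l ℓ : SetFun (n G)) →
    ZeroOnEmpty l → Nonincreasing l → IntersectingSupermodular 1 l →
    ZeroOnEmpty ℓ → IntersectingSupermodular 2 ℓ → Subadditive ℓ →
    (∀ v → 2 * pt ℓ v + 2 * pt l v ≤ degree G v) →
    (∀ (A B : Subset (n G)) → A ∩ B ≡ ⊥ → A ∪ B ⊂ ⊤ →
    sumPt ℓ (A ∪ B) < eIn G ⊤ (A ∪ B) + ℓ (A ∪ B) →
    (A ≡ ⊥ → 2 * ℓ (A ∪ B) ≤ dMinus G B A + sumPt ℓ B) ×
    (Nonempty A → 2 * ℓ (A ∪ B) + 2 * l (A ∪ B) ≤ dMinus G B A + sumPt ℓ B)) →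
    ∀ (M : Subset (m G)) → ∣ M ∣ ≤ l ⊤ + ℓ ⊤ →
    ∃₂ λ (F₁ F₂ : Subset (m G)) →
    (M ∩ F₁ ≡ ⊥) × (M ∩ F₂ ≡ ⊥) × (F₁ ∩ F₂ ≡ ⊥) × (M ∪ F₁ ∪ F₂ ≡ ⊤) ×
    PartitionConnected G l F₁ × Rigid G ℓ F₂
theorem6p1 G l ℓ l⊥ l-dec l-super ℓ⊥ ℓ-super ℓ-sub deg conn M M≤
  with Packing.packing G l ℓ l⊥ l-dec l-super ℓ⊥ ℓ-super ℓ-sub deg conn M M≤
... | F₁ , F , (sparse₁ , tight₁) , (sparse , tight) , M∩F₁ , M∩F , F₁∩F =
  -- All edges outside `M` and `F₁` go to the last subgraph `R`, including the waste edges not in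
  -- `M`; the tight set `F` inside it witnesses rigidity.
  F₁ , R , M∩F₁ , empty-ext (λ e p → rest e (inj₁ (proj₁ (∩-elim M R p))) (proj₂ (∩-elim M R p))) ,
  empty-ext (λ e p → rest e (inj₂ (proj₁ (∩-elim F₁ R p))) (proj₂ (∩-elim F₁ R p))) ,
  trans (sym (∪-assoc M F₁ R)) (∪-inverseʳ (M ∪ F₁)) ,
  PartitionConnectivity.tight⇒partitionConnected G l F₁ sparse₁ tight₁ , F , F⊆R , sparse , tight
  where
  R : Subset (m G)
  R = ∁ (M ∪ F₁)
  rest : ∀ e → lookup M e ≡ true ⊎ lookup F₁ e ≡ true → lookup R e ≡ true → Empty
  rest e p q = true≢false (in-union p) (not-true⇒false (trans (sym (lookup-∁ (M ∪ F₁) e)) q))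
    where
    in-union : lookup M e ≡ true ⊎ lookup F₁ e ≡ true → lookup (M ∪ F₁) e ≡ true
    in-union (inj₁ r) = ∪-introˡ M F₁ r
    in-union (inj₂ r) = ∪-introʳ M F₁ r
  meets-nothing : ∀ (X : Subset (m G)) {e} → X ∩ F ≡ ⊥ → lookup X e ≡ true → lookup F e ≡ true → Empty
  meets-nothing X {e} X∩F p q = true≢false (trans (cong (λ Z → lookup Z e) (sym X∩F)) (∩-intro X F p q)) (lookup-⊥ e)
  F⊆R : F ⊆ R
  F⊆R {e} e∈F with lookup (M ∪ F₁) e in eq
  ... | false = lookup⇒[]= e R (trans (lookup-∁ (M ∪ F₁) e) (cong not eq))
  ... | true with ∪-elim M F₁ eq
  ... | inj₁ p = absurd (meets-nothing M M∩F p ([]=⇒lookup e∈F))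
  ... | inj₂ p = absurd (meets-nothing F₁ F₁∩F p ([]=⇒lookup e∈F))
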